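{- Let $n$ and $t$ be integers such that $n\ge1$ and $0\le t\le n-1$. Then $$|\mathcal{IS}_{n,t}(102)|=|\mathcal{UVD}_{n,t}|=\sum_{j=t+1}^{n}(-1)^{n-j}\,\frac{t+1}{j}\binom{3j-t-2}{j-t-1}\binom{j}{n-j}.$$
   Context: An inversion sequence of length $n$ is an integer sequence $e=(e_1,\dots,e_n)$ with $0\le e_j\le j-1$ for all $j$. It avoids $102$ if there are no $i<j<k$ with $e_j<e_i<e_k$. $\max(e)$ is the largest entry, and $\mathrm{fdes}(e)$ is the position $p$ of the first descent: $e_1\le\cdots\le e_p>e_{p+1}$, with the convention $e_{n+1}=-1$. For a $102$-avoiding $e$, $\mathrm{rank}(e):=\mathrm{fdes}(e)-\max(e)-1$. $\mathcal{IS}_{n,t}(102)$ is the set of $102$-avoiding inversion sequences $e$ of length $n$ with $\mathrm{rank}(e)=t$. A UVD path of semilength $n$ is a lattice path from $(0,0)$ to $(2n,0)$ staying weakly above the $x$-axis, with steps $u=(1,1)$, $d=(1,-1)$, $v=(0,-2)$, with no consecutive $uv$ or $vu$, ending with a $d$ step. $\mathrm{vox}(S)$ is the number of valleys $du$ of $S$ on the $x$-axis. $\mathcal{UVD}_{n,t}$ is the set of UVD paths $S$ of semilength $n$ with $\mathrm{vox}(S)=t$. -}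

module Defs where

open import Data.Bool using (if_then_else_)
open import Data.Fin as Fin using (Fin; toℕ)
open import Data.Integer as ℤ using (ℤ; +_; 0ℤ; 1ℤ; -1ℤ)
open import Data.List as List using (List; []; _∷_; foldl; last)
open import Data.List.Relation.Unary.All using (All)
open import Data.List.Relation.Unary.Linked using (Linked)
open import Data.List.Scans.Base using (scanl)
open import Data.Maybe using (just)
open import Data.Nat as ℕ using (ℕ; suc; _+_; _*_; _∸_; _⊔_; _≤_; _<_; NonZero)
open import Data.Nat.Combinatorics using (_C_)
open import Data.Product using (_×_; _,_; proj₂)
open import Data.Rational as ℚ using (ℚ; 0ℚ; _/_)
open import Data.Refinement using (Refinement-syntax)
open import Data.Vec as Vec using (Vec; []; _∷_; lookup)
open import Relation.Binary.PropositionalEquality using (_≡_)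
open import Relation.Nullary using (¬_; does)

-- Positions are 0-based: `lookup e i` is the entry e_{toℕ i + 1}, so the
-- bound e_j ≤ j − 1 becomes `lookup e i ≤ toℕ i`.
IsInversionSequence : ∀ {n} → Vec ℕ n → Set
IsInversionSequence e = ∀ i → lookup e i ≤ toℕ i

Avoids102 : ∀ {n} → Vec ℕ n → Set
Avoids102 e = ∀ i j k → i Fin.< j → j Fin.< k →
  ¬ (lookup e j < lookup e i × lookup e i < lookup e k)

-- Since entries are natural numbers, 0 is a harmless starting value.
max : ∀ {n} → Vec ℕ n → ℕ
max = Vec.foldr′ _⊔_ 0

-- The 1-based position p of the first descent e_p > e_{p+1}.  The singleton
-- case is the convention e_{n+1} = −1; the value at [] is a dummy.
fdes : ∀ {n} → Vec ℕ n → ℕ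
fdes []           = 0
fdes (x ∷ [])     = 1
fdes (x ∷ y ∷ ys) = if does (x ℕ.≤? y) then suc (fdes (y ∷ ys)) else 1

rank : ∀ {n} → Vec ℕ n → ℤ
rank e = + fdes e ℤ.- + max e ℤ.- 1ℤ

-- Membership proofs in a refinement type are irrelevant, so its elements
-- are counted as bare sequences (and, below, bare words of steps).
IS102 : ℕ → ℕ → Set
IS102 n t = [ e ∈ Vec ℕ n ∣ IsInversionSequence e × Avoids102 e × rank e ≡ + t ]

data Step : Set where
  u d v : Step

Point : Set
Point = ℤ × ℤ

origin : Point
origin = 0ℤ , 0ℤ

move : Point → Step → Point
move (x , y) u = x ℤ.+ 1ℤ , y ℤ.+ 1ℤ
move (x , y) d = x ℤ.+ 1ℤ , y ℤ.- 1ℤ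
move (x , y) v = x        , y ℤ.- + 2

record IsUVDPath (n : ℕ) (S : List Step) : Set where
  field
    endpoint  : foldl move origin S ≡ (+ (2 * n) , 0ℤ)
    aboveAxis : All (λ p → 0ℤ ℤ.≤ proj₂ p) (scanl move origin S)
    noUVorVU  : Linked (λ a b → ¬ (a ≡ u × b ≡ v) × ¬ (a ≡ v × b ≡ u)) S
    endsWithD : last S ≡ just d

voxFrom : Point → List Step → ℕ
voxFrom p []          = 0
voxFrom p (d ∷ u ∷ S) =
  (if does (proj₂ (move p d) ℤ.≟ 0ℤ) then 1 else 0) + voxFrom (move p d) (u ∷ S)
voxFrom p (s ∷ S)     = voxFrom (move p s) S

vox : List Step → ℕ
vox = voxFrom origin

UVD : ℕ → ℕ → Set
UVD n t = [ S ∈ List Step ∣ IsUVDPath n S × vox S ≡ t ]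

-- For t + 1 ≤ j ≤ n none of the truncated subtractions truncates.
summand : (n t j : ℕ) .{{_ : NonZero j}} → ℚ
summand n t j =
  ((-1ℤ ℤ.^ (n ∸ j)) / 1) ℚ.* (+ (t + 1) / j)
    ℚ.* (+ ((3 * j ∸ t ∸ 2) C (j ∸ t ∸ 1)) / 1)
    ℚ.* (+ (j C (n ∸ j)) / 1)

-- The sum over j = t + 1, …, n, with j written as suc (t + i) for
-- 0 ≤ i < n ∸ t so that j is visibly nonzero.
alternatingSum : ℕ → ℕ → ℚ
alternatingSum n t =
  List.foldr ℚ._+_ 0ℚ (List.map (λ i → summand n t (suc (t + i))) (List.upTo (n ∸ t)))

-- Let W = x + ⋯ be the power series with W(1 − W)² = x − x².  Lagrange inversion in x − x²
-- turns the alternating sum into [xⁿ] Wᵗ⁺¹, and both families are shown to have this count.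
--
-- Paths: removing the last step gives a linear system for the numbers of path prefixes with
-- prescribed end height and last step; it is solved by the coefficients of Wᵗ(1 − W)⁻ʰ
-- (last step u, end height h + 1), Wᵗ⁺¹(1 − W)⁻ʰ (d, height h) and (W − x)Wᵗ(1 − W)⁻ʰ⁻¹
-- (v, height h).
--
-- Inversion sequences: put S(n, s) = {e : fdes e = max e + s}, so that rank e = t means
-- e ∈ S(n, t + 1).  Let X(n, s) be the set of e with fdes e > max e + s whose entry at the
-- 0-based position max e + s is max e.  Inserting the value q − s at position q is a bijection
-- from {(e, q) : max e + s ≤ q ≤ fdes e} onto X(n + 1, s), and S(n + 1, s + 1) is the part of
-- X(n + 1, s) where fdes e = max e + s + 1, while the rest of X(n + 1, s) arises from X(n, s)
-- by repeating the maximum.  Hence |S(n + 1, s + 1)| is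
-- Σ_{k ≥ s} (k − s + 1) (|S(n, k)| − |S(n − 1, k)|), which is the recursion of [xⁿ] Wˢ.
module Submission where

open import Defs
open import Data.Bool using (if_then_else_)
open import Data.Fin as Fin using (Fin; zero; suc; toℕ; fromℕ<; punchIn; punchOut; _↑ˡ_; _↑ʳ_; splitAt)
import Data.Fin.Properties as Fin
open import Data.Integer as ℤ using (ℤ; +_; 0ℤ; 1ℤ; -1ℤ)
import Data.Integer.Properties as ℤ
import Data.Integer.Tactic.RingSolver as ℤSolver
open import Data.Irrelevant using ([_])
open import Data.List as List using (List; []; _∷_; _∷ʳ_; reverse; upTo; applyUpTo)
import Data.List.Properties as List
open import Data.List.Relation.Unary.All using (All; []; _∷_)
import Data.List.Relation.Unary.All.Properties as All
open import Data.List.Relation.Unary.Linked using (Linked; []; [-]; _∷_)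
import Data.List.Relation.Unary.Linked.Properties as Linked
open import Data.List.Scans.Base using (scanl)
open import Data.Maybe using (just)
open import Data.Maybe.Relation.Binary.Connected as Connected using (Connected)
open import Data.Nat as ℕ using (ℕ; zero; suc; _+_; _*_; _∸_; _≤_; _<_; z≤n; s≤s)
open import Data.Nat.Combinatorics
  using (_C_; nCn≡1; nC1≡n; nCk≡nC[n∸k]; k>n⇒nCk≡0; nCk+nC[k+1]≡[n+1]C[k+1])
open import Data.Nat.DivMod using (_mod_; m<n⇒m%n≡m)
import Data.Nat.Properties as ℕ
import Data.Nat.Tactic.RingSolver as ℕSolver
open import Data.Product using (_×_; _,_; ∃-syntax; proj₁; proj₂)
open import Data.Rational as ℚ using (0ℚ; _/_)
import Data.Rational.Properties as ℚ
open import Data.Rational.Unnormalised using (mkℚᵘ; _≃_; *≡*)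
import Data.Rational.Unnormalised.Properties as ℚᵘ
open import Data.Refinement using (Refinement; Refinement-syntax; _,_; value-injective)
open import Data.Sum using (_⊎_; inj₁; inj₂; [_,_]′)
open import Data.Vec as Vec using (Vec; []; _∷_; lookup; insertAt; removeAt)
import Data.Vec.Properties as Vec
open import Function using (_∘_; case_of_; flip)
open import Function.Bundles using (_↔_; mk↔ₛ′)
open import Relation.Binary using (DecidableEquality; tri<; tri≈; tri>)
open import Relation.Binary.PropositionalEquality
open import Relation.Nullary using (¬_; yes; no; contradiction; does)
open import Relation.Nullary.Decidable using (recompute; dec-true; dec-false)
open import Relation.Unary using (Decidable)

open ≡-Reasoning

-- Coefficients of Wˢ(1 − W)⁻ʰ

-- A k m = [yᵐ] (1 − 3y)(1 − y)⁻ᵏ.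
A : ℕ → ℕ → ℤ
A k             zero          = 1ℤ
A zero          (suc zero)    = ℤ.- + 3
A zero          (suc (suc m)) = 0ℤ
A (suc k)       (suc m)       = A (suc k) m ℤ.+ A k (suc m)

-- β n j = [xⁿ] (x − x²)ʲ.
β : ℕ → ℕ → ℤ
β zero          zero    = 1ℤ
β (suc n)       zero    = 0ℤ
β zero          (suc j) = 0ℤ
β (suc zero)    (suc j) = β zero j
β (suc (suc n)) (suc j) = β (suc n) j ℤ.- β n j

∑ : (ℕ → ℤ) → ℕ → ℤ
∑ f zero    = 0ℤ
∑ f (suc n) = f zero ℤ.+ ∑ (f ∘ suc) n

∑-cong : ∀ {f g} → (∀ i → f i ≡ g i) → ∀ n → ∑ f n ≡ ∑ g n
∑-cong f≗g zero    = refl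
∑-cong f≗g (suc n) = cong₂ ℤ._+_ (f≗g 0) (∑-cong (f≗g ∘ suc) n)

∑-zero : ∀ {f} → (∀ i → f i ≡ 0ℤ) → ∀ n → ∑ f n ≡ 0ℤ
∑-zero f≗0 zero    = refl
∑-zero f≗0 (suc n) = cong₂ ℤ._+_ (f≗0 0) (∑-zero (f≗0 ∘ suc) n)

∑-distrib-+ : ∀ f g n → ∑ (λ i → f i ℤ.+ g i) n ≡ ∑ f n ℤ.+ ∑ g n
∑-distrib-+ f g zero    = refl
∑-distrib-+ f g (suc n) = begin
  (f 0 ℤ.+ g 0) ℤ.+ ∑ (λ i → f (suc i) ℤ.+ g (suc i)) n
    ≡⟨ cong (λ z → (f 0 ℤ.+ g 0) ℤ.+ z) (∑-distrib-+ (f ∘ suc) (g ∘ suc) n) ⟩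
  (f 0 ℤ.+ g 0) ℤ.+ (∑ (f ∘ suc) n ℤ.+ ∑ (g ∘ suc) n)
    ≡⟨ interchange (f 0) (g 0) (∑ (f ∘ suc) n) (∑ (g ∘ suc) n) ⟩
  (f 0 ℤ.+ ∑ (f ∘ suc) n) ℤ.+ (g 0 ℤ.+ ∑ (g ∘ suc) n) ∎
  where
  interchange : ∀ a b c e → (a ℤ.+ b) ℤ.+ (c ℤ.+ e) ≡ (a ℤ.+ c) ℤ.+ (b ℤ.+ e)
  interchange = ℤSolver.solve-∀

∑-distrib-neg : ∀ f n → ∑ (λ i → ℤ.- f i) n ≡ ℤ.- ∑ f n
∑-distrib-neg f zero    = refl
∑-distrib-neg f (suc n) =
  trans (cong (ℤ._+_ (ℤ.- f 0)) (∑-distrib-neg (f ∘ suc) n))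
        (sym (ℤ.neg-distrib-+ (f 0) (∑ (f ∘ suc) n)))

∑-extend : ∀ f k {n} → (∀ i → n ≤ i → f i ≡ 0ℤ) → ∑ f (n + k) ≡ ∑ f n
∑-extend f k {zero}  vanish = ∑-zero (λ i → vanish i z≤n) k
∑-extend f k {suc n} vanish =
  cong (ℤ._+_ (f 0)) (∑-extend (f ∘ suc) k (λ i n≤i → vanish (suc i) (s≤s n≤i)))

n<j⇒β≡0 : ∀ {n j} → n < j → β n j ≡ 0ℤ
n<j⇒β≡0 {zero}        {suc j} _         = refl
n<j⇒β≡0 {suc zero}    {suc j} (s≤s 0<j) = n<j⇒β≡0 0<j
n<j⇒β≡0 {suc (suc n)} {suc j} (s≤s n<j) =
  cong₂ ℤ._-_ (n<j⇒β≡0 n<j) (n<j⇒β≡0 (ℕ.<-trans (ℕ.n<1+n n) n<j))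

-- Lagrange inversion in the form [zʲ] F(W) = [wʲ] F(w) φ(w)ʲ (1 - w φ′(w)/φ(w)), with z = x - x², φ
-- = (1 - w)⁻², F = wˢ(1 - w)⁻ʰ and j = s + i. The last factor is (1 - 3w)/(1 - w), whence the
-- numerator in `A` and the `suc` in its first index.
term : (n s h i : ℕ) → ℤ
term n s h i = β n (s + i) ℤ.* A (suc h + 2 * (s + i)) i

-- G n s h = [xⁿ] Wˢ(1 − W)⁻ʰ for the power series W = x + ⋯ with W(1 − W)² = x − x²
-- (Lagrange inversion in x − x²).
G : (n s h : ℕ) → ℤ
G n s h = ∑ (term n s h) (suc n)

term≡0 : ∀ n s h i → n < s + i → term n s h i ≡ 0ℤ
term≡0 n s h i n<s+i = cong (ℤ._* A (suc h + 2 * (s + i)) i) (n<j⇒β≡0 n<s+i)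

-- Terms with s + i > n contain no power of x low enough, so sums of different lengths can be
-- compared when a recursion shifts `n` or `s`.
∑-term-extend : ∀ k n s h N → n < s + N → ∑ (term n s h) (N + k) ≡ ∑ (term n s h) N
∑-term-extend k n s h N n<s+N = ∑-extend (term n s h) k
  λ i N≤i → term≡0 n s h i (ℕ.<-≤-trans n<s+N (ℕ.+-monoʳ-≤ s N≤i))

n<s⇒G≡0 : ∀ n s h → n < s → G n s h ≡ 0ℤ
n<s⇒G≡0 n s h n<s =
  ∑-zero (λ i → term≡0 n s h i (ℕ.<-≤-trans n<s (ℕ.m≤m+n s i))) (suc n)

-- 1 = (1 − W) + W.
G-h : ∀ n s h → G n s (suc h) ≡ G n s h ℤ.+ G n (suc s) (suc h)
G-h n s h = begin
  -- The zeroth terms for `h` and `suc h` agree because `A k 0` is 1 for every `k`; the recursion of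
  -- `A` splits all the others.
  term n s h 0 ℤ.+ ∑ (term n s (suc h) ∘ suc) n
    ≡⟨ cong (ℤ._+_ (term n s h 0)) (trans (∑-cong pascal n)
         (∑-distrib-+ (term n s h ∘ suc) (term n (suc s) (suc h)) n)) ⟩
  term n s h 0 ℤ.+ (∑ (term n s h ∘ suc) n ℤ.+ ∑ (term n (suc s) (suc h)) n)
    ≡⟨ ℤ.+-assoc (term n s h 0) _ _ ⟨
  G n s h ℤ.+ ∑ (term n (suc s) (suc h)) n
    ≡⟨ cong (ℤ._+_ (G n s h)) (∑-term-extend 1 n (suc s) (suc h) n (s≤s (ℕ.m≤n+m n s))) ⟨
  G n s h ℤ.+ ∑ (term n (suc s) (suc h)) (n + 1)
    ≡⟨ cong (λ N → G n s h ℤ.+ ∑ (term n (suc s) (suc h)) N) (ℕ.+-comm n 1) ⟩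
  G n s h ℤ.+ G n (suc s) (suc h) ∎
  where
  pascal : ∀ i → term n s (suc h) (suc i) ≡ term n s h (suc i) ℤ.+ term n (suc s) (suc h) i
  pascal i rewrite ℕ.+-suc s i =
    trans (ℤ.*-distribˡ-+ (β n (suc (s + i))) (A (suc (suc h) + 2 * suc (s + i)) i) _)
          (ℤ.+-comm (β n (suc (s + i)) ℤ.* A (suc (suc h) + 2 * suc (s + i)) i) _)

1+h+2*[1+j] : ∀ h j → suc h + 2 * suc j ≡ suc (suc (suc h)) + 2 * j
1+h+2*[1+j] = ℕSolver.solve-∀

-- One factor x - x² of (x - x²)ʲ⁺¹ lowers the degree by one or two; the exponent 2(j + 1) exceeds
-- 2j by two, and this surplus is moved into `h`.
term-s : ∀ n s h i → term (suc (suc n)) (suc s) h i ≡ term (suc n) s (suc (suc h)) i ℤ.- term n s (suc (suc h)) i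
term-s n s h i = begin
  (β (suc n) (s + i) ℤ.- β n (s + i)) ℤ.* A (suc h + 2 * suc (s + i)) i
    ≡⟨ cong (λ k → (β (suc n) (s + i) ℤ.- β n (s + i)) ℤ.* A k i) (1+h+2*[1+j] h (s + i)) ⟩
  (β (suc n) (s + i) ℤ.- β n (s + i)) ℤ.* A (suc (suc (suc h)) + 2 * (s + i)) i
    ≡⟨ distrib (β (suc n) (s + i)) (β n (s + i)) _ ⟩
  term (suc n) s (suc (suc h)) i ℤ.- term n s (suc (suc h)) i ∎
  where
  distrib : ∀ a b c → (a ℤ.- b) ℤ.* c ≡ a ℤ.* c ℤ.- b ℤ.* c
  distrib = ℤSolver.solve-∀

-- W(1 − W)² = x − x².
G-s : ∀ n s h → G (suc (suc n)) (suc s) h ≡ G (suc n) s (suc (suc h)) ℤ.- G n s (suc (suc h))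
G-s n s h = begin
  G (suc (suc n)) (suc s) h
    ≡⟨ ∑-cong (term-s n s h) (3 + n) ⟩
  ∑ (λ i → T₁ i ℤ.- T₀ i) (3 + n)
    ≡⟨ trans (∑-distrib-+ T₁ (λ i → ℤ.- T₀ i) (3 + n))
             (cong (ℤ._+_ (∑ T₁ (3 + n))) (∑-distrib-neg T₀ (3 + n))) ⟩
  ∑ T₁ (3 + n) ℤ.- ∑ T₀ (3 + n)
    ≡⟨ cong₂ ℤ._-_ (cong (∑ T₁) (ℕ.+-comm 1 (2 + n))) (cong (∑ T₀) (ℕ.+-comm 2 (1 + n))) ⟩
  ∑ T₁ (2 + n + 1) ℤ.- ∑ T₀ (1 + n + 2)
    ≡⟨ cong₂ ℤ._-_ (∑-term-extend 1 (suc n) s (2 + h) (2 + n) (ℕ.m≤n+m (2 + n) s))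
                     (∑-term-extend 2 n s (2 + h) (1 + n) (ℕ.m≤n+m (1 + n) s)) ⟩
  G (suc n) s (suc (suc h)) ℤ.- G n s (suc (suc h)) ∎
  where
  T₁ T₀ : ℕ → ℤ
  T₁ = term (suc n) s (suc (suc h))
  T₀ = term n s (suc (suc h))

-- The lowest degree of the same recursion, where x - x² can contribute only through x.
G₁-s : ∀ s h → G 1 (suc s) h ≡ G 0 s (suc (suc h))
G₁-s s h = begin
  ∑ (term 1 (suc s) h) 2
    ≡⟨ ∑-term-extend 1 1 (suc s) h 1 (s≤s (ℕ.m≤n+m 1 s)) ⟩
  ∑ (term 1 (suc s) h) 1
    ≡⟨ cong (λ k → β 0 (s + 0) ℤ.* A k 0 ℤ.+ 0ℤ) (1+h+2*[1+j] h (s + 0)) ⟩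
  G 0 s (suc (suc h)) ∎

-- Binomial closed forms

nC0≡1 : ∀ n → n C 0 ≡ 1
nC0≡1 n = trans (nCk≡nC[n∸k] {0} {n} z≤n) (nCn≡1 n)

-- Both sides count the (m + 1)-subsets of k + m elements with one marked element: the mark is
-- chosen last on the left and within the subset on the right.
C-absorption : ∀ k m → k * ((k + m) C m) ≡ suc m * ((k + m) C suc m)
C-absorption zero    m       = sym (trans (cong (suc m *_) (k>n⇒nCk≡0 (ℕ.n<1+n m))) (ℕ.*-zeroʳ (suc m)))
C-absorption (suc k) zero    rewrite nC0≡1 (suc k + 0) | nC1≡n (suc k + 0) | ℕ.+-identityʳ k =
  ℕ.*-comm (suc k) 1
C-absorption (suc k) (suc m)
  rewrite sym (nCk+nC[k+1]≡[n+1]C[k+1] (k + suc m) m)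
        | sym (nCk+nC[k+1]≡[n+1]C[k+1] (k + suc m) (suc m))
  = begin
  suc k * (c₀ + c₁)                   ≡⟨ ℕ.*-distribˡ-+ (suc k) c₀ c₁ ⟩
  suc k * c₀ + (c₁ + k * c₁)          ≡⟨ cong₂ (λ a b → a + (c₁ + b)) lower (C-absorption k (suc m)) ⟩
  suc m * c₁ + (c₁ + suc (suc m) * c₂) ≡⟨ regroup m c₁ c₂ ⟩
  suc (suc m) * (c₁ + c₂)             ∎
  where
  c₀ = (k + suc m) C m
  c₁ = (k + suc m) C suc m
  c₂ = (k + suc m) C suc (suc m)
  lower : suc k * c₀ ≡ suc m * c₁
  lower = subst (λ N → suc k * (N C m) ≡ suc m * (N C suc m)) (sym (ℕ.+-suc k m)) (C-absorption (suc k) m)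
  regroup : ∀ m a b → suc m * a + (a + suc (suc m) * b) ≡ suc (suc m) * (a + b)
  regroup = ℕSolver.solve-∀

C-pascal : ∀ n k → + (suc n C suc k) ≡ + (n C k) ℤ.+ + (n C suc k)
C-pascal n k = cong +_ (sym (nCk+nC[k+1]≡[n+1]C[k+1] n k))

-- The coefficients of (1 - y)⁻ᵏ⁻¹ are the binomials C(k + m, m), and 1 - 3y combines two
-- consecutive ones.
A-binomial : ∀ k m → A (suc k) (suc m) ≡ + ((k + suc m) C suc m) ℤ.- + 3 ℤ.* + ((k + m) C m)
A-binomial zero    zero    = refl
A-binomial zero    (suc m) = begin
  A 1 (suc m) ℤ.+ 0ℤ    ≡⟨ ℤ.+-identityʳ _ ⟩
  A 1 (suc m)           ≡⟨ A-binomial zero m ⟩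
  + (suc m C suc m) ℤ.- + 3 ℤ.* + (m C m)
    ≡⟨ cong₂ (λ a b → + a ℤ.- + 3 ℤ.* + b)
         (trans (nCn≡1 (suc m)) (sym (nCn≡1 (suc (suc m)))))
         (trans (nCn≡1 m) (sym (nCn≡1 (suc m)))) ⟩
  + (suc (suc m) C suc (suc m)) ℤ.- + 3 ℤ.* + (suc m C suc m) ∎
A-binomial (suc k) zero    = begin
  1ℤ ℤ.+ A (suc k) 1
    ≡⟨ cong (ℤ._+_ 1ℤ) (A-binomial k zero) ⟩
  1ℤ ℤ.+ (+ ((k + 1) C 1) ℤ.- + 3 ℤ.* + ((k + 0) C 0))
    ≡⟨ ℤ.+-assoc 1ℤ (+ ((k + 1) C 1)) (ℤ.- (+ 3 ℤ.* + ((k + 0) C 0))) ⟨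
  + suc ((k + 1) C 1) ℤ.- + 3 ℤ.* + ((k + 0) C 0)
    ≡⟨ cong₂ (λ a b → + a ℤ.- + 3 ℤ.* + b)
         (trans (cong suc (nC1≡n (k + 1))) (sym (nC1≡n (suc k + 1))))
         (trans (nC0≡1 (k + 0)) (sym (nC0≡1 (suc k + 0)))) ⟩
  + ((suc k + 1) C 1) ℤ.- + 3 ℤ.* + ((suc k + 0) C 0) ∎
A-binomial (suc k) (suc m)
  rewrite A-binomial (suc k) m | A-binomial k (suc m) | ℕ.+-suc k (suc m) | ℕ.+-suc k m
  = begin
  (+ a ℤ.- + 3 ℤ.* + b) ℤ.+ (+ c ℤ.- + 3 ℤ.* + e)
    ≡⟨ regroup (+ a) (+ b) (+ c) (+ e) ⟩
  (+ a ℤ.+ + c) ℤ.- + 3 ℤ.* (+ b ℤ.+ + e)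
    ≡⟨ cong₂ (λ p q → p ℤ.- + 3 ℤ.* q) (C-pascal (suc (suc (k + m))) (suc m)) (C-pascal (suc (k + m)) m) ⟨
  + (suc (suc (suc (k + m))) C suc (suc m)) ℤ.- + 3 ℤ.* + (suc (suc (k + m)) C suc m) ∎
  where
  a = suc (suc (k + m)) C suc m
  b = suc (k + m) C m
  c = suc (suc (k + m)) C suc (suc m)
  e = suc (k + m) C suc m
  regroup : ∀ a b c e → (a ℤ.- + 3 ℤ.* b) ℤ.+ (c ℤ.- + 3 ℤ.* e) ≡ (a ℤ.+ c) ℤ.- + 3 ℤ.* (b ℤ.+ e)
  regroup = ℤSolver.solve-∀

-- This factored form exposes the zero at 2m = k + 1, which is what `G-zero` needs; in `A-ballot`
-- the same factor becomes 2(t + 1).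
A-closed : ∀ k m → + suc k ℤ.* A (suc (suc k)) m ≡ (+ suc k ℤ.- + (2 * m)) ℤ.* + ((k + m) C m)
A-closed k zero    rewrite nC0≡1 (k + 0) = cong (ℤ._* 1ℤ) (sym (ℤ.+-identityʳ (+ suc k)))
A-closed k (suc m) = begin
  + suc k ℤ.* A (suc (suc k)) (suc m)
    ≡⟨ cong (ℤ._*_ (+ suc k)) (A-binomial (suc k) m) ⟩
  + suc k ℤ.* (+ (suc (k + suc m) C suc m) ℤ.- + 3 ℤ.* + P)
    ≡⟨ cong (λ c → + suc k ℤ.* (c ℤ.- + 3 ℤ.* + P)) (C-pascal (k + suc m) m) ⟩
  + suc k ℤ.* ((+ ((k + suc m) C m) ℤ.+ + Y) ℤ.- + 3 ℤ.* + P)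
    ≡⟨ cong (λ N → + suc k ℤ.* ((+ (N C m) ℤ.+ + Y) ℤ.- + 3 ℤ.* + P)) (ℕ.+-suc k m) ⟩
  + suc k ℤ.* ((+ P ℤ.+ + Y) ℤ.- + 3 ℤ.* + P)
    ≡⟨ expand (+ suc k) (+ P) (+ Y) ⟩
  + suc k ℤ.* + Y ℤ.- + 2 ℤ.* (+ suc k ℤ.* + P)
    ≡⟨ cong (λ c → + suc k ℤ.* + Y ℤ.- + 2 ℤ.* c) absorb ⟩
  + suc k ℤ.* + Y ℤ.- + 2 ℤ.* (+ suc m ℤ.* + Y)
    ≡⟨ collect (+ suc k) (+ suc m) (+ Y) ⟩
  (+ suc k ℤ.- + 2 ℤ.* + suc m) ℤ.* + Y
    ≡⟨ cong (λ c → (+ suc k ℤ.- c) ℤ.* + Y) (ℤ.pos-* 2 (suc m)) ⟨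
  (+ suc k ℤ.- + (2 * suc m)) ℤ.* + Y ∎
  where
  P = suc (k + m) C m
  Y = (k + suc m) C suc m
  absorb : + suc k ℤ.* + P ≡ + suc m ℤ.* + Y
  absorb = begin
    + suc k ℤ.* + P       ≡⟨ ℤ.pos-* (suc k) P ⟨
    + (suc k * P)         ≡⟨ cong +_ (C-absorption (suc k) m) ⟩
    + (suc m * (suc (k + m) C suc m)) ≡⟨ cong (λ N → + (suc m * (N C suc m))) (ℕ.+-suc k m) ⟨
    + (suc m * Y)         ≡⟨ ℤ.pos-* (suc m) Y ⟩
    + suc m ℤ.* + Y       ∎
  expand : ∀ a p y → a ℤ.* ((p ℤ.+ y) ℤ.- + 3 ℤ.* p) ≡ a ℤ.* y ℤ.- + 2 ℤ.* (a ℤ.* p)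
  expand = ℤSolver.solve-∀
  collect : ∀ a b y → a ℤ.* y ℤ.- + 2 ℤ.* (b ℤ.* y) ≡ (a ℤ.- + 2 ℤ.* b) ℤ.* y
  collect = ℤSolver.solve-∀

-- The series is W⁰(1 - W)⁰ = 1. Term by term, `β` kills i = 0 and `A` kills every i > 0. This is
-- the boundary value of both counting recursions.
G-zero : ∀ n → G (suc n) 0 0 ≡ 0ℤ
G-zero n = trans (ℤ.+-identityˡ _) (∑-zero vanish (suc n))
  where
  A≡0 : ∀ i → A (suc (2 * suc i)) (suc i) ≡ 0ℤ
  A≡0 i = ℤ.*-cancelˡ-≡ (+ (2 * suc i)) _ _ (begin
    + (2 * suc i) ℤ.* A (suc (2 * suc i)) (suc i)
      -- The first argument is the unfolded predecessor of 2(i + 1), the value at which the linear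
      -- factor vanishes.
      ≡⟨ A-closed (i + suc (i + 0)) (suc i) ⟩
    (+ (2 * suc i) ℤ.- + (2 * suc i)) ℤ.* c
      ≡⟨ cong (ℤ._* c) (ℤ.+-inverseʳ (+ (2 * suc i))) ⟩
    0ℤ
      ≡⟨ ℤ.*-zeroʳ (+ (2 * suc i)) ⟨
    + (2 * suc i) ℤ.* 0ℤ ∎)
    where c = + ((i + suc (i + 0) + suc i) C suc i)
  vanish : ∀ i → term (suc n) 0 0 (suc i) ≡ 0ℤ
  vanish i = trans (cong (ℤ._*_ (β (suc n) (suc i))) (A≡0 i)) (ℤ.*-zeroʳ (β (suc n) (suc i)))

-- Binomial expansion of (x - x²)ʲ = xʲ(1 - x)ʲ.
β-closed : ∀ m j → β (m + j) j ≡ -1ℤ ℤ.^ m ℤ.* + (j C m)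
β-closed zero          zero          = refl
β-closed (suc m)       zero          = sym (trans (cong (λ c → -1ℤ ℤ.^ suc m ℤ.* + c) (k>n⇒nCk≡0 {0} {suc m} (s≤s z≤n)))
                                         (ℤ.*-zeroʳ (-1ℤ ℤ.^ suc m)))
β-closed zero          (suc zero)    = refl
β-closed zero          (suc (suc j)) = begin
  β (suc j) (suc j) ℤ.- β j (suc j) ≡⟨ cong₂ ℤ._-_ (β-closed 0 (suc j)) (n<j⇒β≡0 (ℕ.n<1+n j)) ⟩
  1ℤ ℤ.* + (suc j C 0) ℤ.- 0ℤ       ≡⟨ ℤ.+-identityʳ _ ⟩
  1ℤ ℤ.* + (suc j C 0)              ≡⟨ cong (λ c → 1ℤ ℤ.* + c) (trans (nC0≡1 (suc j)) (sym (nC0≡1 (suc (suc j))))) ⟩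
  1ℤ ℤ.* + (suc (suc j) C 0)        ∎
β-closed (suc m)       (suc j)       rewrite ℕ.+-suc m j = begin
  β (suc (m + j)) j ℤ.- β (m + j) j
    ≡⟨ cong₂ ℤ._-_ (β-closed (suc m) j) (β-closed m j) ⟩
  -1ℤ ℤ.* σ ℤ.* + (j C suc m) ℤ.- σ ℤ.* + (j C m)
    ≡⟨ regroup σ (+ (j C m)) (+ (j C suc m)) ⟩
  -1ℤ ℤ.* σ ℤ.* (+ (j C m) ℤ.+ + (j C suc m))
    ≡⟨ cong (ℤ._*_ (-1ℤ ℤ.* σ)) (C-pascal j m) ⟨
  -1ℤ ℤ.* σ ℤ.* + (suc j C suc m) ∎
  where
  σ = -1ℤ ℤ.^ m
  regroup : ∀ σ a b → -1ℤ ℤ.* σ ℤ.* b ℤ.- σ ℤ.* a ≡ -1ℤ ℤ.* σ ℤ.* (a ℤ.+ b)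
  regroup = ℤSolver.solve-∀

-- Put j = t + 1 + i, so that 2j - 2i = 2(t + 1) in `A-closed`. That identity carries the factor 2j
-- instead of j, hence the cancellation of 2. Multiplying by j keeps the ballot-type number (t +
-- 1)/j · C(3j - t - 2, i) within the integers.
A-ballot : ∀ t i → + suc (t + i) ℤ.* A (suc (2 * suc (t + i))) i
                 ≡ + suc t ℤ.* + ((3 * suc (t + i) ∸ t ∸ 2) C i)
A-ballot t i = ℤ.*-cancelˡ-≡ (+ 2) _ _ (begin
  + 2 ℤ.* (+ suc (t + i) ℤ.* A (suc (2 * suc (t + i))) i)
    ≡⟨ ℤ.*-assoc (+ 2) (+ suc (t + i)) _ ⟨
  + 2 ℤ.* + suc (t + i) ℤ.* A (suc (2 * suc (t + i))) i
    ≡⟨ cong (ℤ._* A (suc (2 * suc (t + i))) i) (ℤ.pos-* 2 (suc (t + i))) ⟨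
  + (2 * suc (t + i)) ℤ.* A (suc (2 * suc (t + i))) i
    ≡⟨ A-closed _ i ⟩
  (+ (2 * suc (t + i)) ℤ.- + (2 * i)) ℤ.* + c
    ≡⟨ cong (λ a → (+ a ℤ.- + (2 * i)) ℤ.* + c) (split t i) ⟩
  (+ (2 * suc t) ℤ.+ + (2 * i) ℤ.- + (2 * i)) ℤ.* + c
    ≡⟨ cong (ℤ._* + c) (cancel (+ (2 * suc t)) (+ (2 * i))) ⟩
  + (2 * suc t) ℤ.* + c
    ≡⟨ cong₂ (λ a N → a ℤ.* + (N C i)) (ℤ.pos-* 2 (suc t)) (sym top) ⟩
  + 2 ℤ.* + suc t ℤ.* + ((3 * suc (t + i) ∸ t ∸ 2) C i)
    ≡⟨ ℤ.*-assoc (+ 2) (+ suc t) _ ⟩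
  + 2 ℤ.* (+ suc t ℤ.* + ((3 * suc (t + i) ∸ t ∸ 2) C i)) ∎)
  where
  k = t + i + suc (t + i + 0)
  c = (k + i) C i
  split : ∀ t i → 2 * suc (t + i) ≡ 2 * suc t + 2 * i
  split = ℕSolver.solve-∀
  cancel : ∀ a b → a ℤ.+ b ℤ.- b ≡ a
  cancel = ℤSolver.solve-∀
  shift : ∀ t i → 3 * suc (t + i) ≡ t + (2 + (t + i + suc (t + i + 0) + i))
  shift = ℕSolver.solve-∀
  top : 3 * suc (t + i) ∸ t ∸ 2 ≡ k + i
  top = trans (cong (λ N → N ∸ t ∸ 2) (shift t i)) (cong (_∸ 2) (ℕ.m+n∸m≡n t (2 + (k + i))))

-- The alternating sum

-- Normalisation by the gcd hides numerators and denominators; among unnormalised fractions an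
-- equation is just a cross-multiplication.
toℚᵘ-/ : ∀ i j → ℚ.toℚᵘ (i / suc j) ≃ mkℚᵘ i j
toℚᵘ-/ i j = ℚ.toℚᵘ-fromℚᵘ (mkℚᵘ i j)

/1-homo-+ : ∀ a b → (a / 1) ℚ.+ (b / 1) ≡ (a ℤ.+ b) / 1
/1-homo-+ a b = ℚ.toℚᵘ-injective (ℚᵘ.≃-trans (ℚ.toℚᵘ-homo-+ (a / 1) (b / 1))
  (ℚᵘ.≃-trans (ℚᵘ.+-cong (toℚᵘ-/ a 0) (toℚᵘ-/ b 0))
  (ℚᵘ.≃-trans (*≡* (cancel a b)) (ℚᵘ.≃-sym (toℚᵘ-/ (a ℤ.+ b) 0)))))
  where
  cancel : ∀ a b → (a ℤ.* + 1 ℤ.+ b ℤ.* + 1) ℤ.* + 1 ≡ (a ℤ.+ b) ℤ.* + 1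
  cancel = ℤSolver.solve-∀

foldr-∑ : ∀ f g n → (∀ {i} → i < n → f i ≡ g i / 1) →
          List.foldr ℚ._+_ 0ℚ (List.map f (upTo n)) ≡ ∑ g n / 1
foldr-∑ f g n f≗g = trans (cong (List.foldr ℚ._+_ 0ℚ) (List.map-upTo f n)) (go f g n f≗g)
  where
  go : ∀ f g n → (∀ {i} → i < n → f i ≡ g i / 1) →
       List.foldr ℚ._+_ 0ℚ (applyUpTo f n) ≡ ∑ g n / 1
  go f g zero    f≗g = refl
  go f g (suc n) f≗g =
    trans (cong₂ ℚ._+_ (f≗g (s≤s z≤n)) (go (f ∘ suc) (g ∘ suc) n (f≗g ∘ s≤s)))
          (/1-homo-+ (g 0) (∑ (g ∘ suc) n))

-- The fraction a/j need not be an integer, but a·c/j is the integer x by hypothesis, so the whole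
-- product is integral.
scale-/ : ∀ {σ a c b x j} → + suc j ℤ.* x ≡ a ℤ.* c →
          (σ / 1) ℚ.* (a / suc j) ℚ.* (c / 1) ℚ.* (b / 1) ≡ (σ ℤ.* b ℤ.* x) / 1
scale-/ {σ} {a} {c} {b} {x} {j} jx≡ac = ℚ.toℚᵘ-injective (ℚᵘ.≃-trans
  (ℚᵘ.≃-trans (ℚ.toℚᵘ-homo-* (σ / 1 ℚ.* (a / suc j) ℚ.* (c / 1)) (b / 1)) (ℚᵘ.*-cong
    (ℚᵘ.≃-trans (ℚ.toℚᵘ-homo-* (σ / 1 ℚ.* (a / suc j)) (c / 1)) (ℚᵘ.*-cong
      (ℚᵘ.≃-trans (ℚ.toℚᵘ-homo-* (σ / 1) (a / suc j)) (ℚᵘ.*-cong (toℚᵘ-/ σ 0) (toℚᵘ-/ a j)))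
      (toℚᵘ-/ c 0)))
    (toℚᵘ-/ b 0)))
  (ℚᵘ.≃-trans (*≡* cross) (ℚᵘ.≃-sym (toℚᵘ-/ (σ ℤ.* b ℤ.* x) 0))))
  where
  left : ∀ σ a c b → σ ℤ.* a ℤ.* c ℤ.* b ℤ.* + 1 ≡ σ ℤ.* b ℤ.* (a ℤ.* c)
  left = ℤSolver.solve-∀
  right : ∀ σ b j x → σ ℤ.* b ℤ.* (j ℤ.* x) ≡ σ ℤ.* b ℤ.* x ℤ.* (+ 1 ℤ.* j ℤ.* + 1 ℤ.* + 1)
  right = ℤSolver.solve-∀
  cross : σ ℤ.* a ℤ.* c ℤ.* b ℤ.* + 1 ≡ σ ℤ.* b ℤ.* x ℤ.* + (1 * suc j * 1 * 1)
  cross = begin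
    σ ℤ.* a ℤ.* c ℤ.* b ℤ.* + 1        ≡⟨ left σ a c b ⟩
    σ ℤ.* b ℤ.* (a ℤ.* c)              ≡⟨ cong (ℤ._*_ (σ ℤ.* b)) jx≡ac ⟨
    σ ℤ.* b ℤ.* (+ suc j ℤ.* x)        ≡⟨ right σ b (+ suc j) x ⟩
    σ ℤ.* b ℤ.* x ℤ.* (+ 1 ℤ.* + suc j ℤ.* + 1 ℤ.* + 1)
      ≡⟨ cong (ℤ._*_ (σ ℤ.* b ℤ.* x)) (trans (cong (λ z → z ℤ.* + 1 ℤ.* + 1) (sym (ℤ.pos-* 1 (suc j))))
          (trans (cong (ℤ._* + 1) (sym (ℤ.pos-* (1 * suc j) 1))) (sym (ℤ.pos-* (1 * suc j * 1) 1)))) ⟩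
    σ ℤ.* b ℤ.* x ℤ.* + (1 * suc j * 1 * 1) ∎

-- `A-ballot` absorbs the division by j, and `β-closed` accounts for the sign and the last binomial;
-- j ≤ n makes n ∸ j a true difference.
summand≡term : ∀ n t i → suc (t + i) ≤ n → summand n t (suc (t + i)) ≡ term n (suc t) 0 i / 1
summand≡term n t i j≤n = trans
  (scale-/ {σ = -1ℤ ℤ.^ (n ∸ suc (t + i))} {a = + (t + 1)}
           {c = + ((3 * suc (t + i) ∸ t ∸ 2) C (suc (t + i) ∸ t ∸ 1))}
           {b = + (suc (t + i) C (n ∸ suc (t + i)))} {j = t + i} ballot)
  (cong (λ z → (z ℤ.* A (suc (2 * suc (t + i))) i) / 1)
     (trans (sym (β-closed (n ∸ suc (t + i)) (suc (t + i))))
            (cong (λ m → β m (suc (t + i))) (ℕ.m∸n+n≡m j≤n))))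
  where
  ballot : + suc (t + i) ℤ.* A (suc (2 * suc (t + i))) i
         ≡ + (t + 1) ℤ.* + ((3 * suc (t + i) ∸ t ∸ 2) C (suc (t + i) ∸ t ∸ 1))
  ballot rewrite ℕ.+-comm t 1 | sym (ℕ.+-suc t i) | ℕ.m+n∸m≡n t (suc i) | ℕ.+-suc t i = A-ballot t i

alternatingSum≡G : ∀ {n t} → t < n → alternatingSum n t ≡ G n (suc t) 0 / 1
alternatingSum≡G {n} {t} t<n = trans
  (foldr-∑ (λ i → summand n t (suc (t + i))) (term n (suc t) 0) (n ∸ t)
     (λ {i} i<n∸t → summand≡term n t i
       (subst (t + i <_) (ℕ.m+[n∸m]≡n (ℕ.<⇒≤ t<n)) (ℕ.+-monoʳ-< t i<n∸t))))
  -- The given sum ends at j = n, while `G` has `suc t` further terms, all with j > n and hence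
  -- zero.
  (cong (_/ 1) (trans (sym (∑-term-extend (suc t) n (suc t) 0 (n ∸ t) (s≤s (ℕ.≤-reflexive (sym t+[n∸t])))))
                      (cong (∑ (term n (suc t) 0)) (trans (ℕ.+-comm (n ∸ t) (suc t)) (cong suc t+[n∸t])))))
  where
  t+[n∸t] : t + (n ∸ t) ≡ n
  t+[n∸t] = ℕ.m+[n∸m]≡n (ℕ.<⇒≤ t<n)

-- Counted subsets

-- Only the bare elements are enumerated, so proofs of `P` are never compared. This fits the
-- irrelevant membership proofs of refinement types.
record Counted {A : Set} (P : A → Set) (k : ℕ) : Set where
  field
    enum      : Fin k → A
    injective : ∀ {i j} → enum i ≡ enum j → i ≡ j
    sound     : ∀ i → P (enum i)
    complete  : ∀ {a} → P a → ∃[ i ] enum i ≡ a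

open Counted

module _ {A : Set} {P : A → Set} where

  counted-∅ : (∀ {a} → ¬ P a) → Counted P 0
  counted-∅ ¬P = record
    { enum = λ () ; injective = λ {} ; sound = λ () ; complete = λ p → contradiction p ¬P }

  counted-singleton : ∀ a → P a → (∀ {b} → P b → a ≡ b) → Counted P 1
  counted-singleton a p unique = record
    { enum      = λ _ → a
    ; injective = λ { {zero} {zero} _ → refl }
    ; sound     = λ _ → p
    ; complete  = λ q → zero , unique q
    }

  counted-image : ∀ {B : Set} {Q : B → Set} {k} (f : A → B) →
                  (∀ {a} → P a → Q (f a)) →
                  (∀ {a a′} → P a → P a′ → f a ≡ f a′ → a ≡ a′) →
                  (∀ {b} → Q b → ∃[ a ] P a × f a ≡ b) →
                  Counted P k → Counted Q k
  counted-image f P⇒Q f-injective f-surjective c = record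
    { enum      = f ∘ enum c
    ; injective = λ {i} {j} eq → injective c (f-injective (sound c i) (sound c j) eq)
    ; sound     = P⇒Q ∘ sound c
    ; complete  = λ q → let a , p , fa≡b = f-surjective q
                            i , ci≡a = complete c p
                        in i , trans (cong f ci≡a) fa≡b
    }

  counted-⇔ : ∀ {Q : A → Set} {k} → (∀ {a} → P a → Q a) → (∀ {a} → Q a → P a) →
              Counted P k → Counted Q k
  counted-⇔ P⇒Q Q⇒P = counted-image (λ a → a) P⇒Q (λ _ _ eq → eq) (λ q → _ , Q⇒P q , refl)

  counted-unique : ∀ {k l} → Counted P k → Counted P l → k ≡ l
  counted-unique c c′ = ℕ.≤-antisym (card-≤ c c′) (card-≤ c′ c)
    where
    card-≤ : ∀ {k l} → Counted P k → Counted P l → k ≤ l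
    card-≤ c c′ = Fin.injective⇒≤ {f = proj₁ ∘ hit} λ {i} {j} eq → injective c
      (trans (sym (proj₂ (hit i))) (trans (cong (enum c′) eq) (proj₂ (hit j))))
      where
      hit : ∀ i → ∃[ j ] enum c′ j ≡ enum c i
      hit i = complete c′ (sound c i)

  counted-⊎ : ∀ {Q : A → Set} {k l} → (∀ {a} → P a → ¬ Q a) →
              Counted P k → Counted Q l → Counted (λ a → P a ⊎ Q a) (k + l)
  counted-⊎ {Q} {k} {l} disjoint c c′ = record
    { enum = e ∘ splitAt k
    ; injective = λ {i} {j} eq →
        trans (sym (Fin.join-splitAt k l i))
          (trans (cong (Fin.join k l) (e-injective (splitAt k i) (splitAt k j) eq)) (Fin.join-splitAt k l j))
    ; sound = λ i → e-sound (splitAt k i)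
    ; complete = λ
      { (inj₁ p) → let i , eq = complete c p in i ↑ˡ l , trans (cong e (Fin.splitAt-↑ˡ k i l)) eq
      ; (inj₂ q) → let j , eq = complete c′ q in k ↑ʳ j , trans (cong e (Fin.splitAt-↑ʳ k l j)) eq }
    }
    where
    e : Fin k ⊎ Fin l → A
    e = [ enum c , enum c′ ]′
    e-injective : ∀ x y → e x ≡ e y → x ≡ y
    e-injective (inj₁ i) (inj₁ j) eq = cong inj₁ (injective c eq)
    e-injective (inj₁ i) (inj₂ j) eq = contradiction (subst Q (sym eq) (sound c′ j)) (disjoint (sound c i))
    e-injective (inj₂ i) (inj₁ j) eq = contradiction (subst Q eq (sound c′ i)) (disjoint (sound c j))
    e-injective (inj₂ i) (inj₂ j) eq = cong inj₂ (injective c′ eq)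
    e-sound : ∀ x → P (e x) ⊎ Q (e x)
    e-sound (inj₁ i) = inj₁ (sound c i)
    e-sound (inj₂ j) = inj₂ (sound c′ j)

  counted-↔ : ∀ {k} → DecidableEquality A → Counted P k → [ a ∈ A ∣ P a ] ↔ Fin k
  counted-↔ {k} _≟_ c = mk↔ₛ′ (λ r → proj₁ (index r)) (λ i → enum c i , [ sound c i ])
    (λ i → injective c (proj₂ (index (enum c i , [ sound c i ]))))
    (λ r → value-injective (proj₂ (index r)))
    where
    index : (r : [ a ∈ A ∣ P a ]) → ∃[ i ] enum c i ≡ Refinement.value r
    -- The proof `p` is irrelevant, so no index can be extracted from it; existence of an index is
    -- decidable by finite search, which lets `recompute` produce a usable one.
    index (a , [ p ]) = recompute (Fin.any? (λ i → enum c i ≟ a)) (complete c p)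

counted-tail : ∀ {A : Set} {P : A → Set} {k} (c : Counted P (suc k)) →
               Counted (λ a → P a × enum c zero ≢ a) k
counted-tail c = record
  { enum      = enum c ∘ suc
  ; injective = Fin.suc-injective ∘ injective c
  ; sound     = λ i → sound c (suc i) , λ eq → contradiction (injective c eq) λ ()
  ; complete  = λ (p , a≢) → avoid a≢ (complete c p)
  }
  where
  avoid : ∀ {a} → enum c zero ≢ a → ∃[ i ] enum c i ≡ a → ∃[ i ] enum c (suc i) ≡ a
  avoid a≢ (zero  , eq) = contradiction eq a≢
  avoid a≢ (suc i , eq) = i , eq

-- Finiteness of the filtered set is enough here: `card-difference` determines its size from that of
-- the complement and the uniqueness of counts.
counted-filter : ∀ {A : Set} {P R : A → Set} {k} → Decidable R → Counted P k →
                 ∃[ l ] Counted (λ a → P a × R a) l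
counted-filter {k = zero}  R? c = 0 , counted-∅ λ (p , _) → Fin.¬Fin0 (proj₁ (complete c p))
counted-filter {A} {P} {R} {suc k} R? c with counted-filter R? (counted-tail c) | R? (enum c zero)
... | l , c′ | no ¬r = l , counted-⇔ (λ ((p , _) , r) → p , r)
                             (λ (p , r) → (p , λ { refl → ¬r r }) , r) c′
... | l , c′ | yes r = suc l , counted-⇔ ⇒ ⇐ (counted-⊎ (λ eq ((_ , a≢) , _) → a≢ eq)
                         (counted-singleton (enum c zero) refl λ eq → eq) c′)
  where
  ⇒ : ∀ {a} → enum c zero ≡ a ⊎ (P a × enum c zero ≢ a) × R a → P a × R a
  ⇒ (inj₁ refl)          = sound c zero , r
  ⇒ (inj₂ ((p , _) , r)) = p , r
  ⇐ : ∀ {a} → P a × R a → enum c zero ≡ a ⊎ (P a × enum c zero ≢ a) × R a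
  ⇐ (p , r) with complete c p
  ... | zero  , eq = inj₁ eq
  ... | suc i , eq = inj₂ ((p , λ eq₀ → contradiction (injective c (trans eq₀ (sym eq))) λ ()) , r)

-- Sizes are recorded in ℤ because the coefficients `G` are integers obeying recursions with
-- subtraction.
Card : {A : Set} → (A → Set) → ℤ → Set
Card P z = ∃[ k ] Counted P k × + k ≡ z

card-∅ : {A : Set} {P : A → Set} → (∀ {a} → ¬ P a) → Card P 0ℤ
card-∅ ¬P = 0 , counted-∅ ¬P , refl

card-⊎ : {A : Set} {P Q : A → Set} {x y : ℤ} → (∀ {a} → P a → ¬ Q a) →
         Card P x → Card Q y → Card (λ a → P a ⊎ Q a) (x ℤ.+ y)
card-⊎ disjoint (k , c , refl) (l , c′ , refl) = k + l , counted-⊎ disjoint c c′ , refl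

card-image : {A B : Set} {P : A → Set} {Q : B → Set} {x y : ℤ} (f : A → B) →
             (∀ {a} → P a → Q (f a)) →
             (∀ {a a′} → P a → P a′ → f a ≡ f a′ → a ≡ a′) →
             (∀ {b} → Q b → ∃[ a ] P a × f a ≡ b) →
             x ≡ y → Card P x → Card Q y
card-image f P⇒Q inj surj refl (k , c , eq) = k , counted-image f P⇒Q inj surj c , eq

card-difference : {A : Set} {P R : A → Set} {x y : ℤ} → Decidable R →
                  Card P x → Card (λ a → P a × ¬ R a) y → Card (λ a → P a × R a) (x ℤ.- y)
card-difference R? (k , c , refl) (l , c′ , refl) with counted-filter R? c
... | m , c″ = m , c″ , trans (cancel (+ m) (+ l)) (cong (λ k → + k ℤ.- + l) (sym k≡m+l))
  where
  cancel : ∀ a b → a ≡ a ℤ.+ b ℤ.- b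
  cancel = ℤSolver.solve-∀
  k≡m+l : k ≡ m + l
  k≡m+l = counted-unique c (counted-⇔ [ proj₁ , proj₁ ]′
    (λ {a} p → case R? a of λ { (yes r) → inj₁ (p , r) ; (no ¬r) → inj₂ (p , ¬r) })
    (counted-⊎ (λ (_ , r) (_ , ¬r) → ¬r r) c″ c′))

-- UVD paths

-- Words w are read backwards: w ∈ 𝒰 n h t (resp. 𝒟, 𝒱) when reverse w is an admissible
-- path with t valleys on the axis whose last step is u and ends at (2n + h + 1, h + 1)
-- (resp. is d or v and ends at (2n + h, h)).
mutual
  data 𝒰 : (n h t : ℕ) → List Step → Set where
    start : 𝒰 0 0 0 (u ∷ [])
    du₀   : ∀ {n t w} → 𝒟 n 0 t w → 𝒰 n 0 (suc t) (u ∷ w)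
    uu    : ∀ {n h t w} → 𝒰 n h t w → 𝒰 n (suc h) t (u ∷ w)
    du    : ∀ {n h t w} → 𝒟 n (suc h) t w → 𝒰 n (suc h) t (u ∷ w)

  data 𝒟 : (n h t : ℕ) → List Step → Set where
    ud : ∀ {n h t w} → 𝒰 n h t w → 𝒟 (suc n) h t (d ∷ w)
    dd : ∀ {n h t w} → 𝒟 n (suc h) t w → 𝒟 (suc n) h t (d ∷ w)
    vd : ∀ {n h t w} → 𝒱 n (suc h) t w → 𝒟 (suc n) h t (d ∷ w)

  data 𝒱 : (n h t : ℕ) → List Step → Set where
    dv : ∀ {n h t w} → 𝒟 n (suc (suc h)) t w → 𝒱 (suc n) h t (v ∷ w)
    vv : ∀ {n h t w} → 𝒱 n (suc (suc h)) t w → 𝒱 (suc n) h t (v ∷ w)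

𝒰-head : ∀ {n h t w} → 𝒰 n h t w → ∃[ w′ ] w ≡ u ∷ w′
𝒰-head start   = _ , refl
𝒰-head (du₀ _) = _ , refl
𝒰-head (uu _)  = _ , refl
𝒰-head (du _)  = _ , refl

𝒟-head : ∀ {n h t w} → 𝒟 n h t w → ∃[ w′ ] w ≡ d ∷ w′
𝒟-head (ud _) = _ , refl
𝒟-head (dd _) = _ , refl
𝒟-head (vd _) = _ , refl

𝒱-head : ∀ {n h t w} → 𝒱 n h t w → ∃[ w′ ] w ≡ v ∷ w′
𝒱-head (dv _) = _ , refl
𝒱-head (vv _) = _ , refl

𝒰∩𝒟 : ∀ {n h t n′ h′ t′ w} → 𝒰 n h t w → ¬ 𝒟 n′ h′ t′ w
𝒰∩𝒟 p q with 𝒰-head p | 𝒟-head q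
... | _ , refl | _ , ()

𝒰∩𝒱 : ∀ {n h t n′ h′ t′ w} → 𝒰 n h t w → ¬ 𝒱 n′ h′ t′ w
𝒰∩𝒱 p q with 𝒰-head p | 𝒱-head q
... | _ , refl | _ , ()

𝒟∩𝒱 : ∀ {n h t n′ h′ t′ w} → 𝒟 n h t w → ¬ 𝒱 n′ h′ t′ w
𝒟∩𝒱 p q with 𝒟-head p | 𝒱-head q
... | _ , refl | _ , ()

-- R n t h = [xⁿ] (W − x)Wᵗ(1 − W)⁻ʰ.
R : (n t h : ℕ) → ℤ
R zero    t h = 0ℤ
R (suc n) t h = G (suc n) (suc t) h ℤ.- G n t h

-- W = x/(1 − W) + x(W − x)/(1 − W)².
G-R : ∀ n t h → G (suc n) (suc t) h ≡ G n t (suc h) ℤ.+ R n t (suc (suc h))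
G-R zero    t h = begin
  G 1 (suc t) h                        ≡⟨ G₁-s t h ⟩
  G 0 t (suc (suc h))                  ≡⟨ G-h 0 t (suc h) ⟩
  G 0 t (suc h) ℤ.+ G 0 (suc t) (suc (suc h))
    ≡⟨ cong (ℤ._+_ (G 0 t (suc h))) (n<s⇒G≡0 0 (suc t) (suc (suc h)) (s≤s z≤n)) ⟩
  G 0 t (suc h) ℤ.+ 0ℤ                 ∎
G-R (suc n) t h = begin
  G (suc (suc n)) (suc t) h                                            ≡⟨ G-s n t h ⟩
  G (suc n) t (suc (suc h)) ℤ.- G n t (suc (suc h))
    ≡⟨ cong (ℤ._- G n t (suc (suc h))) (G-h (suc n) t (suc h)) ⟩
  G (suc n) t (suc h) ℤ.+ G (suc n) (suc t) (suc (suc h)) ℤ.- G n t (suc (suc h))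
    ≡⟨ ℤ.+-assoc (G (suc n) t (suc h)) (G (suc n) (suc t) (suc (suc h))) (ℤ.- G n t (suc (suc h))) ⟩
  G (suc n) t (suc h) ℤ.+ R (suc n) t (suc (suc h)) ∎

-- W - x = xW/(1 - W) + x(W - x)/(1 - W)², which is the previous identity with x subtracted from
-- both sides.
R-R : ∀ n t h → R (suc n) t h ≡ G n (suc t) (suc h) ℤ.+ R n t (suc (suc h))
R-R n t h = begin
  G (suc n) (suc t) h ℤ.- G n t h
    ≡⟨ cong (ℤ._- G n t h) (trans (G-R n t h) (cong (ℤ._+ R n t (suc (suc h))) (G-h n t h))) ⟩
  G n t h ℤ.+ G n (suc t) (suc h) ℤ.+ R n t (suc (suc h)) ℤ.- G n t h
    ≡⟨ cancel (G n t h) (G n (suc t) (suc h)) (R n t (suc (suc h))) ⟩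
  G n (suc t) (suc h) ℤ.+ R n t (suc (suc h)) ∎
  where
  cancel : ∀ a b c → a ℤ.+ b ℤ.+ c ℤ.- a ≡ b ℤ.+ c
  cancel = ℤSolver.solve-∀

card-∷ : ∀ {P Q : List Step → Set} {x y} s → (∀ {w} → P w → Q (s ∷ w)) →
         (∀ {w} → Q w → ∃[ w′ ] P w′ × s ∷ w′ ≡ w) → x ≡ y → Card P x → Card Q y
card-∷ s P⇒Q Q⇒P = card-image (s ∷_) P⇒Q (λ { _ _ refl → refl }) Q⇒P

mutual
  -- Deleting the last step matches `G-h` for `𝒰`, `G-R` for `𝒟` and `R-R` for `𝒱`. Since n counts
  -- the steps `d` and `v`, deleting one of these lowers n; deleting a `u` lowers h or leaves a word
  -- ending in `d`.
  card-𝒰 : ∀ n h t → Card (𝒰 n h t) (G n t h)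
  card-𝒰 zero    zero    zero    = 1 , counted-singleton (u ∷ []) start (λ { start → refl }) , refl
  -- A `u` leaving the axis opens the path or completes a valley there, as it cannot follow `v`; so
  -- with t = 0 only n = 0 occurs.
  card-𝒰 (suc n) zero    zero    = subst (Card _) (sym (G-zero n)) (card-∅ λ ())
  card-𝒰 n       zero    (suc t) = card-∷ u du₀ (λ { (du₀ p) → _ , p , refl }) refl (card-𝒟 n 0 t)
  card-𝒰 n       (suc h) t       = card-∷ u [ uu , du ]′
    (λ { (uu p) → _ , inj₁ p , refl ; (du p) → _ , inj₂ p , refl })
    (sym (G-h n t h))
    (card-⊎ 𝒰∩𝒟 (card-𝒰 n h t) (card-𝒟 n (suc h) t))

  card-𝒟 : ∀ n h t → Card (𝒟 n h t) (G n (suc t) h)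
  card-𝒟 zero    h t = subst (Card _) (sym (n<s⇒G≡0 0 (suc t) h (s≤s z≤n))) (card-∅ λ ())
  card-𝒟 (suc n) h t = card-∷ d [ [ ud , dd ]′ , vd ]′
    (λ { (ud p) → _ , inj₁ (inj₁ p) , refl ; (dd p) → _ , inj₁ (inj₂ p) , refl ; (vd p) → _ , inj₂ p , refl })
    (trans (cong (ℤ._+ R n t (suc (suc h))) (sym (G-h n t h))) (sym (G-R n t h)))
    (card-⊎ [ 𝒰∩𝒱 , 𝒟∩𝒱 ]′
      (card-⊎ 𝒰∩𝒟 (card-𝒰 n h t) (card-𝒟 n (suc h) t))
      (card-𝒱 n (suc h) t))

  card-𝒱 : ∀ n h t → Card (𝒱 n h t) (R n t (suc h))
  card-𝒱 zero    h t = card-∅ λ ()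
  card-𝒱 (suc n) h t = card-∷ v [ dv , vv ]′
    (λ { (dv p) → _ , inj₁ p , refl ; (vv p) → _ , inj₂ p , refl })
    (sym (R-R n t (suc h)))
    (card-⊎ 𝒟∩𝒱 (card-𝒟 n (suc (suc h)) t) (card-𝒱 n (suc (suc h)) t))

-- Backward words and lattice paths

pos : List Step → Point
pos = List.foldr (flip move) origin

Compatible : Step → Step → Set
Compatible a b = ¬ (a ≡ u × b ≡ v) × ¬ (a ≡ v × b ≡ u)

Path : List Step → Set
Path w = All (λ p → 0ℤ ℤ.≤ proj₂ p) (scanl move origin (reverse w)) × Linked Compatible (reverse w)

scanl-∷ʳ : ∀ {A B : Set} (f : A → B → A) e xs x →
           scanl f e (xs ∷ʳ x) ≡ scanl f e xs ∷ʳ f (List.foldl f e xs) x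
scanl-∷ʳ f e []       x = refl
scanl-∷ʳ f e (y ∷ xs) x = cong (e ∷_) (scanl-∷ʳ f (f e y) xs x)

last-∷ʳ : ∀ {A : Set} (xs : List A) x → List.last (xs ∷ʳ x) ≡ just x
last-∷ʳ []           x = refl
last-∷ʳ (_ ∷ [])     x = refl
last-∷ʳ (_ ∷ y ∷ xs) x = last-∷ʳ (y ∷ xs) x

Linked-∷ʳ⁻ : ∀ {A : Set} {_~_ : A → A → Set} xs {a b} →
             Linked _~_ (xs ∷ʳ a ∷ʳ b) → Linked _~_ (xs ∷ʳ a) × a ~ b
Linked-∷ʳ⁻ []           (r ∷ [-])     = [-] , r
Linked-∷ʳ⁻ (x ∷ [])     (r ∷ r′ ∷ [-]) = r ∷ [-] , r′
Linked-∷ʳ⁻ (x ∷ y ∷ xs) (r ∷ l)       = let l′ , r′ = Linked-∷ʳ⁻ (y ∷ xs) l in r ∷ l′ , r′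

Linked-∷ʳ⁺ : ∀ {A : Set} {_~_ : A → A → Set} xs {a b} →
             Linked _~_ (xs ∷ʳ a) → a ~ b → Linked _~_ (xs ∷ʳ a ∷ʳ b)
Linked-∷ʳ⁺ {_~_ = _~_} xs {a} {b} l r =
  Linked.++⁺ l (subst (λ m → Connected _~_ m (just b)) (sym (last-∷ʳ xs a)) (Connected.just r)) [-]

reverse-∷∷ : ∀ {A : Set} (b a : A) w → reverse (b ∷ a ∷ w) ≡ reverse w ∷ʳ a ∷ʳ b
reverse-∷∷ b a w = trans (List.unfold-reverse b (a ∷ w)) (cong (_∷ʳ b) (List.unfold-reverse a w))

scanl-reverse : ∀ s w → scanl move origin (reverse (s ∷ w)) ≡ scanl move origin (reverse w) ∷ʳ pos (s ∷ w)
scanl-reverse s w = begin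
  scanl move origin (reverse (s ∷ w))   ≡⟨ cong (scanl move origin) (List.unfold-reverse s w) ⟩
  scanl move origin (reverse w ∷ʳ s)    ≡⟨ scanl-∷ʳ move origin (reverse w) s ⟩
  scanl move origin (reverse w) ∷ʳ move (List.foldl move origin (reverse w)) s
    ≡⟨ cong (λ p → scanl move origin (reverse w) ∷ʳ move p s) (List.reverse-foldl move origin w) ⟩
  scanl move origin (reverse w) ∷ʳ pos (s ∷ w) ∎

-- The local contribution of two adjacent steps meeting at height y; it replaces the overlapping
-- clauses of `voxFrom` by one uniform rule.
valley : Step → Step → ℤ → ℕ
valley d u y = if does (y ℤ.≟ 0ℤ) then 1 else 0
valley _ _ y = 0

voxFrom-∷∷ : ∀ p a b S → voxFrom p (a ∷ b ∷ S) ≡ valley a b (proj₂ (move p a)) + voxFrom (move p a) (b ∷ S)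
voxFrom-∷∷ p u b S = refl
voxFrom-∷∷ p v b S = refl
voxFrom-∷∷ p d u S = refl
voxFrom-∷∷ p d d S = refl
voxFrom-∷∷ p d v S = refl

voxFrom-singleton : ∀ p a → voxFrom p (a ∷ []) ≡ 0
voxFrom-singleton p u = refl
voxFrom-singleton p d = refl
voxFrom-singleton p v = refl

+-swap : ∀ a b c → a + (b + c) ≡ b + (a + c)
+-swap = ℕSolver.solve-∀

-- `voxFrom` scans from the start of the path, whereas the words grow at its end; this isolates what
-- the newest step contributes.
voxFrom-∷ʳ : ∀ p S a b → voxFrom p (S ∷ʳ a ∷ʳ b)
           ≡ valley a b (proj₂ (move (List.foldl move p S) a)) + voxFrom p (S ∷ʳ a)
voxFrom-∷ʳ p []          a b = trans (voxFrom-∷∷ p a b [])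
  (cong (ℕ._+_ (valley a b (proj₂ (move p a)))) (trans (voxFrom-singleton (move p a) b) (sym (voxFrom-singleton p a))))
voxFrom-∷ʳ p (s ∷ [])    a b = begin
  voxFrom p (s ∷ a ∷ b ∷ [])
    ≡⟨ voxFrom-∷∷ p s a (b ∷ []) ⟩
  valley s a (proj₂ (move p s)) + voxFrom (move p s) (a ∷ b ∷ [])
    ≡⟨ cong (ℕ._+_ (valley s a (proj₂ (move p s)))) (voxFrom-∷ʳ (move p s) [] a b) ⟩
  valley s a (proj₂ (move p s)) + (valley a b (proj₂ (move (move p s) a)) + voxFrom (move p s) (a ∷ []))
    ≡⟨ +-swap (valley s a (proj₂ (move p s))) (valley a b (proj₂ (move (move p s) a))) _ ⟩
  valley a b (proj₂ (move (move p s) a)) + (valley s a (proj₂ (move p s)) + voxFrom (move p s) (a ∷ []))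
    ≡⟨ cong (ℕ._+_ (valley a b (proj₂ (move (move p s) a)))) (voxFrom-∷∷ p s a []) ⟨
  valley a b (proj₂ (move (move p s) a)) + voxFrom p (s ∷ a ∷ []) ∎
voxFrom-∷ʳ p (s ∷ r ∷ S) a b = begin
  voxFrom p (s ∷ r ∷ S ∷ʳ a ∷ʳ b)
    ≡⟨ voxFrom-∷∷ p s r (S ∷ʳ a ∷ʳ b) ⟩
  valley s r (proj₂ (move p s)) + voxFrom (move p s) (r ∷ S ∷ʳ a ∷ʳ b)
    ≡⟨ cong (ℕ._+_ (valley s r (proj₂ (move p s)))) (voxFrom-∷ʳ (move p s) (r ∷ S) a b) ⟩
  valley s r (proj₂ (move p s)) + (V + voxFrom (move p s) (r ∷ S ∷ʳ a))
    ≡⟨ +-swap (valley s r (proj₂ (move p s))) V _ ⟩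
  V + (valley s r (proj₂ (move p s)) + voxFrom (move p s) (r ∷ S ∷ʳ a))
    ≡⟨ cong (ℕ._+_ V) (voxFrom-∷∷ p s r (S ∷ʳ a)) ⟨
  V + voxFrom p (s ∷ r ∷ S ∷ʳ a) ∎
  where V = valley a b (proj₂ (move (List.foldl move (move (move p s) r) S) a))

record At (w : List Step) (x y t : ℕ) : Set where
  constructor at
  field
    path : Path w
    end  : pos w ≡ (+ x , + y)
    voxʳ : vox (reverse w) ≡ t

open At

-- Only the last two steps need inspection. Staying above the axis is encoded in y′ being a natural
-- number.
at-∷ : ∀ {a b w x y t x′ y′ t′} → Compatible a b → move (+ x , + y) b ≡ (+ x′ , + y′) →
       valley a b (+ y) + t ≡ t′ → At (a ∷ w) x y t → At (b ∷ a ∷ w) x′ y′ t′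
at-∷ {a} {b} {w} {x} {y} {t} compatible moved vox-eq (at (above , linked) end voxʳ) = at
  ( subst (All _) (sym (scanl-reverse b (a ∷ w)))
      (All.∷ʳ⁺ above (subst (λ p → 0ℤ ℤ.≤ proj₂ p) (sym end′) (ℤ.+≤+ z≤n)))
  , subst (Linked _) (sym (reverse-∷∷ b a w))
      (Linked-∷ʳ⁺ (reverse w) (subst (Linked _) (List.unfold-reverse a w) linked) compatible))
  end′
  (begin
    vox (reverse (b ∷ a ∷ w))
      ≡⟨ cong vox (reverse-∷∷ b a w) ⟩
    vox (reverse w ∷ʳ a ∷ʳ b)
      ≡⟨ voxFrom-∷ʳ origin (reverse w) a b ⟩
    valley a b (proj₂ (move (List.foldl move origin (reverse w)) a)) + vox (reverse w ∷ʳ a)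
      ≡⟨ cong₂ (λ p S → valley a b (proj₂ (move p a)) + vox S)
           (List.reverse-foldl move origin w) (sym (List.unfold-reverse a w)) ⟩
    valley a b (proj₂ (pos (a ∷ w))) + vox (reverse (a ∷ w))
      ≡⟨ cong₂ (λ p k → valley a b (proj₂ p) + k) end voxʳ ⟩
    valley a b (+ y) + t
      ≡⟨ vox-eq ⟩
    _ ∎)
  where end′ = trans (cong (λ p → move p b) end) moved

mutual
  𝒰-at : ∀ {n h t w} → 𝒰 n h t w → At w (suc (2 * n + h)) (suc h) t
  𝒰-at start = at ((ℤ.+≤+ z≤n ∷ ℤ.+≤+ z≤n ∷ []) , [-]) refl refl
  𝒰-at {n} (du₀ p) with 𝒟-head p
  ... | _ , refl = at-∷ ((λ ()) , λ ()) (cong (λ x → + x , 1ℤ) (ℕ.+-comm (2 * n + 0) 1)) refl (𝒟-at p)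
  𝒰-at {n} {suc h} (uu p) with 𝒰-head p
  ... | _ , refl = at-∷ ((λ ()) , λ ()) (cong₂ (λ x y → + x , + y) (right n h) (ℕ.+-comm (suc h) 1)) refl (𝒰-at p)
    where
    right : ∀ n h → suc (2 * n + h) + 1 ≡ suc (2 * n + suc h)
    right = ℕSolver.solve-∀
  𝒰-at {n} {suc h} (du p) with 𝒟-head p
  ... | _ , refl =
    at-∷ ((λ ()) , λ ()) (cong₂ (λ x y → + x , + y) (ℕ.+-comm (2 * n + suc h) 1) (ℕ.+-comm (suc h) 1)) refl (𝒟-at p)

  𝒟-at : ∀ {n h t w} → 𝒟 n h t w → At w (2 * n + h) h t
  𝒟-at {suc n} {h} (ud p) with 𝒰-head p
  ... | _ , refl = at-∷ ((λ ()) , λ ()) (cong (λ x → + x , + h) (right n h)) refl (𝒰-at p)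
    where
    right : ∀ n h → suc (2 * n + h) + 1 ≡ 2 * suc n + h
    right = ℕSolver.solve-∀
  𝒟-at {suc n} {h} (dd p) with 𝒟-head p
  ... | _ , refl = at-∷ ((λ ()) , λ ()) (cong (λ x → + x , + h) (2*n+1+h+1 n h)) refl (𝒟-at p)
  𝒟-at {suc n} {h} (vd p) with 𝒱-head p
  ... | _ , refl = at-∷ ((λ ()) , λ ()) (cong (λ x → + x , + h) (2*n+1+h+1 n h)) refl (𝒱-at p)

  𝒱-at : ∀ {n h t w} → 𝒱 n h t w → At w (2 * n + h) h t
  𝒱-at {suc n} {h} (dv p) with 𝒟-head p
  ... | _ , refl = at-∷ ((λ ()) , λ ()) (cong (λ x → + x , + h) (2*n+2+h n h)) refl (𝒟-at p)
  𝒱-at {suc n} {h} (vv p) with 𝒱-head p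
  ... | _ , refl = at-∷ ((λ ()) , λ ()) (cong (λ x → + x , + h) (2*n+2+h n h)) refl (𝒱-at p)

  2*n+1+h+1 : ∀ n h → 2 * n + suc h + 1 ≡ 2 * suc n + h
  2*n+1+h+1 = ℕSolver.solve-∀

  2*n+2+h : ∀ n h → 2 * n + suc (suc h) ≡ 2 * suc n + h
  2*n+2+h = ℕSolver.solve-∀

Classified : List Step → Set
Classified w = ∃[ n ] ∃[ h ] ∃[ t ] (𝒰 n h t w ⊎ 𝒟 n h t w ⊎ 𝒱 n h t w)

path-∷⁻ : ∀ s w → Path (s ∷ w) → Path w × 0ℤ ℤ.≤ proj₂ (pos (s ∷ w))
path-∷⁻ s w (above , linked) =
  let above′ , nonneg = All.∷ʳ⁻ (subst (All _) (scanl-reverse s w) above)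
  in (above′ , init w linked) , nonneg
  where
  init : ∀ w → Linked Compatible (reverse (s ∷ w)) → Linked Compatible (reverse w)
  init []      _ = []
  init (a ∷ w) l = subst (Linked _) (sym (List.unfold-reverse a w))
                     (proj₁ (Linked-∷ʳ⁻ (reverse w) (subst (Linked _) (reverse-∷∷ s a w) l)))

path-compatible : ∀ {b a w} → Path (b ∷ a ∷ w) → Compatible a b
path-compatible {b} {a} {w} (_ , linked) =
  proj₂ (Linked-∷ʳ⁻ (reverse w) (subst (Linked _) (reverse-∷∷ b a w) linked))

nonneg-∷ : ∀ b {w x y t} → At w x y t → 0ℤ ℤ.≤ proj₂ (pos (b ∷ w)) → 0ℤ ℤ.≤ proj₂ (move (+ x , + y) b)
nonneg-∷ b q = subst (λ p → 0ℤ ℤ.≤ proj₂ (move p b)) (end q)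

-- A transition without a constructor either puts `u` next to `v`, against compatibility, or goes
-- below the axis, against nonnegativity.
classify-∷ : ∀ b {a w} → Compatible a b → 0ℤ ℤ.≤ proj₂ (pos (b ∷ a ∷ w)) →
             Classified (a ∷ w) → Classified (b ∷ a ∷ w)
classify-∷ u c nonneg (n , h , t , inj₁ p)            = n , suc h , t , inj₁ (uu p)
classify-∷ d c nonneg (n , h , t , inj₁ p)            = suc n , h , t , inj₂ (inj₁ (ud p))
classify-∷ v c nonneg (n , h , t , inj₁ p) with 𝒰-head p
... | _ , refl = contradiction (refl , refl) (proj₁ c)
classify-∷ u c nonneg (n , zero , t , inj₂ (inj₁ p))  = n , 0 , suc t , inj₁ (du₀ p)
classify-∷ u c nonneg (n , suc h , t , inj₂ (inj₁ p)) = n , suc h , t , inj₁ (du p)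
classify-∷ d c nonneg (n , suc h , t , inj₂ (inj₁ p)) = suc n , h , t , inj₂ (inj₁ (dd p))
classify-∷ v c nonneg (n , suc (suc h) , t , inj₂ (inj₁ p)) = suc n , h , t , inj₂ (inj₂ (dv p))
classify-∷ u c nonneg (n , h , t , inj₂ (inj₂ p)) with 𝒱-head p
... | _ , refl = contradiction (refl , refl) (proj₂ c)
classify-∷ d c nonneg (n , suc h , t , inj₂ (inj₂ p)) = suc n , h , t , inj₂ (inj₁ (vd p))
classify-∷ v c nonneg (n , suc (suc h) , t , inj₂ (inj₂ p)) = suc n , h , t , inj₂ (inj₂ (vv p))
classify-∷ d c nonneg (n , zero , t , inj₂ (inj₁ p)) with () ← nonneg-∷ d (𝒟-at p) nonneg
classify-∷ d c nonneg (n , zero , t , inj₂ (inj₂ p)) with () ← nonneg-∷ d (𝒱-at p) nonneg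
classify-∷ v c nonneg (n , zero , t , inj₂ (inj₁ p)) with () ← nonneg-∷ v (𝒟-at p) nonneg
classify-∷ v c nonneg (n , zero , t , inj₂ (inj₂ p)) with () ← nonneg-∷ v (𝒱-at p) nonneg
classify-∷ v c nonneg (n , suc zero , t , inj₂ (inj₁ p)) with () ← nonneg-∷ v (𝒟-at p) nonneg
classify-∷ v c nonneg (n , suc zero , t , inj₂ (inj₂ p)) with () ← nonneg-∷ v (𝒱-at p) nonneg

classify : ∀ s w → Path (s ∷ w) → Classified (s ∷ w)
classify u []      path = 0 , 0 , 0 , inj₁ start
classify d []      path with () ← proj₂ (path-∷⁻ d [] path)
classify v []      path with () ← proj₂ (path-∷⁻ v [] path)
classify b (a ∷ w) path =
  let path′ , nonneg = path-∷⁻ b (a ∷ w) path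
  in classify-∷ b (path-compatible {w = w} path) nonneg (classify a w path′)

𝒟⇒UVD : ∀ {n t w} → 𝒟 n 0 t w → IsUVDPath n (reverse w) × vox (reverse w) ≡ t
𝒟⇒UVD {n} {t} {w} p with 𝒟-head p | 𝒟-at p
... | w′ , refl | at (above , linked) end voxʳ = record
  { endpoint  = trans (List.reverse-foldl move origin w)
                  (trans end (cong (λ x → + x , 0ℤ) (ℕ.+-identityʳ (2 * n))))
  ; aboveAxis = above
  ; noUVorVU  = linked
  ; endsWithD = trans (cong List.last (List.unfold-reverse d w′)) (last-∷ʳ (reverse w′) d)
  } , voxʳ

-- Classification yields some class and some indices; the final `d` selects `𝒟`, the end point fixes
-- h = 0 and n, and the valley count fixes t.
UVD⇒𝒟 : ∀ {n t} w → IsUVDPath n (reverse w) → vox (reverse w) ≡ t → 𝒟 n 0 t w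
UVD⇒𝒟 []      path vox≡t with () ← IsUVDPath.endsWithD path
UVD⇒𝒟 {n} {t} (s ∷ w) path vox≡t with classify s w (IsUVDPath.aboveAxis path , IsUVDPath.noUVorVU path) | ends-with-d
  where
  ends-with-d : just s ≡ just d
  ends-with-d = trans (sym (last-∷ʳ (reverse w) s))
                  (trans (cong List.last (sym (List.unfold-reverse s w))) (IsUVDPath.endsWithD path))
... | n′ , h , t′ , inj₁ p        | refl with () ← 𝒰-head p
... | n′ , h , t′ , inj₂ (inj₂ p) | refl with () ← 𝒱-head p
... | n′ , h , t′ , inj₂ (inj₁ p) | refl = transport n≡ h≡ (trans (sym (voxʳ (𝒟-at p))) vox≡t) p
  where
  ends : (+ (2 * n′ + h) , + h) ≡ (+ (2 * n) , 0ℤ)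
  ends = trans (sym (end (𝒟-at p))) (trans (sym (List.reverse-foldl move origin (d ∷ w))) (IsUVDPath.endpoint path))
  h≡ : h ≡ 0
  h≡ = ℤ.+-injective (cong proj₂ ends)
  n≡ : n′ ≡ n
  n≡ = ℕ.*-cancelˡ-≡ n′ n 2 (trans (sym (ℕ.+-identityʳ (2 * n′)))
         (trans (cong (ℕ._+_ (2 * n′)) (sym h≡)) (ℤ.+-injective (cong proj₁ ends))))
  transport : n′ ≡ n → h ≡ 0 → t′ ≡ t → 𝒟 n′ h t′ (d ∷ w) → 𝒟 n 0 t (d ∷ w)
  transport refl refl refl p = p

card-UVD : ∀ n t → Card (λ S → IsUVDPath n S × vox S ≡ t) (G n (suc t) 0)
card-UVD n t = card-image reverse 𝒟⇒UVD (λ _ _ → List.reverse-injective)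
  (λ {S} (path , vox≡t) → reverse S
    , UVD⇒𝒟 (reverse S) (subst (IsUVDPath n) (sym (List.reverse-involutive S)) path)
        (trans (cong vox (List.reverse-involutive S)) vox≡t)
    , List.reverse-involutive S)
  refl (card-𝒟 n 0 t)

_≟ˢ_ : DecidableEquality Step
u ≟ˢ u = yes refl
d ≟ˢ d = yes refl
v ≟ˢ v = yes refl
u ≟ˢ d = no λ ()
u ≟ˢ v = no λ ()
d ≟ˢ u = no λ ()
d ≟ˢ v = no λ ()
v ≟ˢ u = no λ ()
v ≟ˢ d = no λ ()

-- 102-avoiding inversion sequences

private variable
  n : ℕ

lookup≤max : ∀ (e : Vec ℕ n) i → lookup e i ≤ max e
lookup≤max (x ∷ e) zero    = ℕ.m≤m⊔n x (max e)
lookup≤max (x ∷ e) (suc i) = ℕ.≤-trans (lookup≤max e i) (ℕ.m≤n⊔m x (max e))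

max-lub : ∀ (e : Vec ℕ n) {m} → (∀ i → lookup e i ≤ m) → max e ≤ m
max-lub []      e≤m = z≤n
max-lub (x ∷ e) e≤m = ℕ.⊔-lub (e≤m zero) (max-lub e (e≤m ∘ suc))

fdes-≤ : ∀ {x y} (e : Vec ℕ n) → x ≤ y → fdes (x ∷ y ∷ e) ≡ suc (fdes (y ∷ e))
fdes-≤ {x = x} {y} e x≤y = cong (if_then suc (fdes (y ∷ e)) else 1) (dec-true (x ℕ.≤? y) x≤y)

fdes-≰ : ∀ {x y} (e : Vec ℕ n) → ¬ x ≤ y → fdes (x ∷ y ∷ e) ≡ 1
fdes-≰ {x = x} {y} e x≰y = cong (if_then suc (fdes (y ∷ e)) else 1) (dec-false (x ℕ.≤? y) x≰y)

fdes≤n : ∀ (e : Vec ℕ n) → fdes e ≤ n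
fdes≤n []          = z≤n
fdes≤n (x ∷ [])    = s≤s z≤n
fdes≤n (x ∷ y ∷ e) with x ℕ.≤? y | fdes≤n (y ∷ e)
... | yes x≤y | p≤n rewrite fdes-≤ e x≤y = s≤s p≤n
... | no  x≰y | _   rewrite fdes-≰ e x≰y = s≤s z≤n

0<fdes : ∀ (e : Vec ℕ (suc n)) → 0 < fdes e
0<fdes (x ∷ [])    = s≤s z≤n
0<fdes (x ∷ y ∷ e) with x ℕ.≤? y
... | yes x≤y rewrite fdes-≤ e x≤y = s≤s z≤n
... | no  x≰y rewrite fdes-≰ e x≰y = s≤s z≤n

Ascending : ℕ → Vec ℕ n → Set
Ascending p e = ∀ i j → i Fin.≤ j → toℕ j < p → lookup e i ≤ lookup e j

fdes-ascending : ∀ (e : Vec ℕ n) → Ascending (fdes e) e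
fdes-ascending (x ∷ e)     zero    zero    _       _ = ℕ.≤-refl
fdes-ascending (x ∷ y ∷ e) i       (suc j) i≤j     j<p with x ℕ.≤? y | fdes-ascending (y ∷ e)
fdes-ascending (x ∷ y ∷ e) zero    (suc j) i≤j     j<p | yes x≤y | asc rewrite fdes-≤ e x≤y =
  ℕ.≤-trans x≤y (asc zero j z≤n (ℕ.≤-pred j<p))
fdes-ascending (x ∷ y ∷ e) (suc i) (suc j) i≤j     j<p | yes x≤y | asc rewrite fdes-≤ e x≤y =
  asc i j (ℕ.≤-pred i≤j) (ℕ.≤-pred j<p)
fdes-ascending (x ∷ y ∷ e) i       (suc j) i≤j     j<p | no x≰y | _ rewrite fdes-≰ e x≰y with s≤s () ← j<p

-- With `fdes-ascending`, this characterises `fdes` as the length of the longest weakly ascending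
-- prefix, the form suited to insertions and removals.
ascending⇒≤fdes : ∀ (e : Vec ℕ n) p → p ≤ n → Ascending p e → p ≤ fdes e
ascending⇒≤fdes e           zero          p≤n     asc = z≤n
ascending⇒≤fdes (x ∷ e)     (suc zero)    p≤n     asc = 0<fdes (x ∷ e)
ascending⇒≤fdes (x ∷ [])    (suc (suc p)) (s≤s ()) asc
ascending⇒≤fdes (x ∷ y ∷ e) (suc (suc p)) (s≤s p≤n) asc
  rewrite fdes-≤ e (asc zero (suc zero) z≤n (s≤s (s≤s z≤n))) =
  s≤s (ascending⇒≤fdes (y ∷ e) (suc p) p≤n λ i j i≤j j<p → asc (suc i) (suc j) (s≤s i≤j) (s≤s j<p))

first-descent : ∀ (e : Vec ℕ n) {i j} → suc (toℕ i) ≡ fdes e → toℕ j ≡ fdes e → lookup e j < lookup e i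
first-descent (x ∷ [])    {zero}  {suc ()} i≡ j≡
first-descent (x ∷ y ∷ e) {i}     {j} i≡ j≡ with x ℕ.≤? y | (λ {i j} → first-descent (y ∷ e) {i} {j})
first-descent (x ∷ y ∷ e) {zero}  {j} i≡ j≡ | yes x≤y | _ rewrite fdes-≤ e x≤y =
  contradiction (ℕ.suc-injective i≡) (ℕ.<⇒≢ (0<fdes (y ∷ e)))
first-descent (x ∷ y ∷ e) {suc i} {suc j} i≡ j≡ | yes x≤y | rec rewrite fdes-≤ e x≤y =
  rec (ℕ.suc-injective i≡) (ℕ.suc-injective j≡)
first-descent (x ∷ y ∷ e) {suc i} {zero} i≡ j≡ | yes x≤y | _ rewrite fdes-≤ e x≤y with () ← j≡
first-descent (x ∷ y ∷ e) {i} {j} i≡ j≡ | no x≰y | _ rewrite fdes-≰ e x≰y =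
  first (Fin.toℕ-injective (ℕ.suc-injective i≡)) (Fin.toℕ-injective j≡)
  where
  first : i ≡ zero → j ≡ suc zero → lookup (x ∷ y ∷ e) j < lookup (x ∷ y ∷ e) i
  first refl refl = ℕ.≰⇒> x≰y

Valid : Vec ℕ n → Set
Valid e = IsInversionSequence e × Avoids102 e

-- A larger entry beyond the first descent would form a 102 with the two entries of that descent.
peak-greatest : ∀ (e : Vec ℕ n) → Valid e → ∀ {i} → suc (toℕ i) ≡ fdes e → ∀ k → lookup e k ≤ lookup e i
peak-greatest {n} e (_ , avoids) {i} i≡ k with ℕ.<-cmp (toℕ k) (suc (toℕ i))
... | tri< (s≤s k≤i) _ _ = fdes-ascending e k i k≤i (ℕ.≤-reflexive i≡)
... | tri≈ _ k≡ _        = ℕ.<⇒≤ (first-descent e i≡ (trans k≡ i≡))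
... | tri> _ _ i+1<k     = ℕ.≮⇒≥ λ i<k → avoids i j k
        (ℕ.≤-reflexive (sym toℕ-j)) (subst (_< toℕ k) (sym toℕ-j) i+1<k)
        (first-descent e i≡ (trans toℕ-j i≡) , i<k)
  where
  i+1<n : suc (toℕ i) < n
  i+1<n = ℕ.<-trans i+1<k (Fin.toℕ<n k)
  j : Fin n
  j = fromℕ< i+1<n
  toℕ-j : toℕ j ≡ suc (toℕ i)
  toℕ-j = Fin.toℕ-fromℕ< i+1<n

peak≡max : ∀ (e : Vec ℕ n) → Valid e → ∀ {i} → suc (toℕ i) ≡ fdes e → lookup e i ≡ max e
peak≡max e valid {i} i≡ = ℕ.≤-antisym (lookup≤max e i) (max-lub e (peak-greatest e valid i≡))

-- The maximum stands at 0-based position `fdes e` - 1, where the inversion condition bounds it.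
-- Ranks are therefore nonnegative.
max<fdes : ∀ (e : Vec ℕ (suc n)) → Valid e → max e < fdes e
max<fdes e valid with fdes e in eq | 0<fdes e | fdes≤n e
... | suc p | _ | p<n = s≤s (ℕ.≤-trans
  (ℕ.≤-reflexive (sym (peak≡max e valid (trans (cong suc toℕ-i) (sym eq)))))
  (ℕ.≤-trans (proj₁ valid i) (ℕ.≤-reflexive toℕ-i)))
  where
  i = fromℕ< p<n
  toℕ-i = Fin.toℕ-fromℕ< p<n

-- Inserting and removing one entry

data PunchView (q : Fin (suc n)) : Fin (suc n) → Set where
  here  : PunchView q q
  punch : ∀ j → PunchView q (punchIn q j)

punchView : ∀ (q i : Fin (suc n)) → PunchView q i
punchView q i with q Fin.≟ i
... | yes refl = here
... | no  q≢i  = subst (PunchView q) (Fin.punchIn-punchOut q≢i) (punch (punchOut q≢i))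

punchIn-mono-< : ∀ q {i j : Fin n} → i Fin.< j → punchIn q i Fin.< punchIn q j
punchIn-mono-< q {i} {j} i<j = ℕ.≰⇒> (ℕ.<⇒≱ i<j ∘ Fin.punchIn-cancel-≤ q j i)

punchIn-cancel-< : ∀ q {i j : Fin n} → punchIn q i Fin.< punchIn q j → i Fin.< j
punchIn-cancel-< q {i} {j} i<j = ℕ.≰⇒> (ℕ.<⇒≱ i<j ∘ Fin.punchIn-mono-≤ q j i)

punchIn-≥ : ∀ q (j : Fin n) → toℕ j ≤ toℕ (punchIn q j)
punchIn-≥ zero    j       = ℕ.n≤1+n _
punchIn-≥ (suc q) zero    = z≤n
punchIn-≥ (suc q) (suc j) = s≤s (punchIn-≥ q j)

punchIn-≤ : ∀ q (j : Fin n) → toℕ (punchIn q j) ≤ suc (toℕ j)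
punchIn-≤ zero    j       = ℕ.≤-refl
punchIn-≤ (suc q) zero    = z≤n
punchIn-≤ (suc q) (suc j) = s≤s (punchIn-≤ q j)

punchIn-below : ∀ q (j : Fin n) → toℕ j < toℕ q → toℕ (punchIn q j) ≡ toℕ j
punchIn-below (suc q) zero    _         = refl
punchIn-below (suc q) (suc j) (s≤s j<q) = cong suc (punchIn-below q j j<q)

punchIn-above : ∀ q (j : Fin n) → toℕ q ≤ toℕ j → toℕ (punchIn q j) ≡ suc (toℕ j)
punchIn-above zero    j       _         = refl
punchIn-above (suc q) (suc j) (s≤s q≤j) = cong suc (punchIn-above q j q≤j)

module _ (e : Vec ℕ n) (q : Fin (suc n)) (x : ℕ) where

  private
    e⁺ = insertAt e q x

  -- Dropping one entry from an ascending prefix of length p + 1 leaves an ascending prefix of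
  -- length at least p.
  fdes-insertAt-≤ : fdes e⁺ ≤ suc (fdes e)
  fdes-insertAt-≤ with fdes e⁺ in eq | fdes≤n e⁺
  ... | zero  | _         = z≤n
  ... | suc p | (s≤s p≤n) = s≤s (ascending⇒≤fdes e p p≤n λ i j i≤j j<p →
    subst₂ _≤_ (Vec.insertAt-punchIn e q x i) (Vec.insertAt-punchIn e q x j)
      (fdes-ascending e⁺ (punchIn q i) (punchIn q j) (Fin.punchIn-mono-≤ q i j i≤j)
        (subst (toℕ (punchIn q j) <_) (sym eq) (s≤s (ℕ.≤-trans (punchIn-≤ q j) j<p)))))

  max-insertAt-≥ : max e ≤ max e⁺
  max-insertAt-≥ = max-lub e λ i →
    subst (_≤ max e⁺) (Vec.insertAt-punchIn e q x i) (lookup≤max e⁺ (punchIn q i))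

  -- Entries right of `q` move left and could break the inversion bound, but each is at most x ≤ q,
  -- which is at most its new position. Avoidance passes to subsequences.
  removeAt-valid : max e⁺ ≡ x → x ≤ toℕ q → Valid e⁺ → Valid e
  removeAt-valid max≡x x≤q (inversion , avoids) = inversion⁻ , avoids⁻
    where
    inversion⁻ : IsInversionSequence e
    inversion⁻ j with ℕ.<-≤-connex (toℕ j) (toℕ q)
    ... | inj₁ j<q = subst₂ _≤_ (Vec.insertAt-punchIn e q x j) (punchIn-below q j j<q) (inversion (punchIn q j))
    ... | inj₂ q≤j = ℕ.≤-trans (ℕ.≤-trans (lookup≤max e j) max-insertAt-≥)
                       (ℕ.≤-trans (ℕ.≤-reflexive max≡x) (ℕ.≤-trans x≤q q≤j))
    avoids⁻ : Avoids102 e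
    avoids⁻ i j k i<j j<k (b<a , a<c) = avoids (punchIn q i) (punchIn q j) (punchIn q k)
      (punchIn-mono-< q i<j) (punchIn-mono-< q j<k)
      ( subst₂ _<_ (sym (Vec.insertAt-punchIn e q x j)) (sym (Vec.insertAt-punchIn e q x i)) b<a
      , subst₂ _<_ (sym (Vec.insertAt-punchIn e q x i)) (sym (Vec.insertAt-punchIn e q x k)) a<c)

  module _ (max≤x : max e ≤ x) where

    lookup-insertAt-≤ : ∀ i → lookup e⁺ i ≤ x
    lookup-insertAt-≤ i with punchView q i
    ... | here    = ℕ.≤-reflexive (Vec.insertAt-lookup e q x)
    ... | punch j = subst (_≤ x) (sym (Vec.insertAt-punchIn e q x j)) (ℕ.≤-trans (lookup≤max e j) max≤x)

    max-insertAt : max e⁺ ≡ x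
    max-insertAt = ℕ.≤-antisym (max-lub e⁺ lookup-insertAt-≤)
      (subst (_≤ max e⁺) (Vec.insertAt-lookup e q x) (lookup≤max e⁺ q))

    module _ (q≤fdes : toℕ q ≤ fdes e) where

      insertAt-ascending : Ascending (suc (toℕ q)) e⁺
      insertAt-ascending i j i≤j j<q+1 with punchView q j
      ... | here = subst (lookup e⁺ i ≤_) (sym (Vec.insertAt-lookup e q x)) (lookup-insertAt-≤ i)
      ... | punch j′ with punchView q i
      ...   | here = contradiction (Fin.toℕ-injective (ℕ.≤-antisym (ℕ.≤-pred j<q+1) i≤j)) (Fin.punchInᵢ≢i q j′)
      ...   | punch i′ = subst₂ _≤_ (sym (Vec.insertAt-punchIn e q x i′)) (sym (Vec.insertAt-punchIn e q x j′))
                (fdes-ascending e i′ j′ (Fin.punchIn-cancel-≤ q i′ j′ i≤j) (ℕ.<-≤-trans j′<q q≤fdes))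
        where
        j′<q : toℕ j′ < toℕ q
        j′<q = ℕ.≤-<-trans (punchIn-≥ q j′)
          (ℕ.≤∧≢⇒< (ℕ.≤-pred j<q+1) (Fin.punchInᵢ≢i q j′ ∘ Fin.toℕ-injective))

      fdes-insertAt-> : toℕ q < fdes e⁺
      fdes-insertAt-> = ascending⇒≤fdes e⁺ (suc (toℕ q)) (Fin.toℕ<n q) insertAt-ascending

      insertAt-valid : x ≤ toℕ q → Valid e → Valid e⁺
      insertAt-valid x≤q (inversion , avoids) = inversion⁺ , avoids⁺
        where
        inversion⁺ : IsInversionSequence e⁺
        inversion⁺ i with punchView q i
        ... | here    = subst (_≤ toℕ q) (sym (Vec.insertAt-lookup e q x)) x≤q
        ... | punch j = subst (_≤ toℕ (punchIn q j)) (sym (Vec.insertAt-punchIn e q x j))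
                          (ℕ.≤-trans (inversion j) (punchIn-≥ q j))
        avoids⁺ : Avoids102 e⁺
        avoids⁺ i j k i<j j<k (b<a , a<c) with punchView q i | punchView q j | punchView q k
        -- The new entry is a maximum, so it could only be the 2 of a 102; that would require a
        -- descent before `q`, inside the ascending prefix.
        ... | here    | _       | _       =
          ℕ.<⇒≱ a<c (subst (lookup e⁺ k ≤_) (sym (Vec.insertAt-lookup e q x)) (lookup-insertAt-≤ k))
        ... | punch _ | here    | _       =
          ℕ.<⇒≱ b<a (subst (lookup e⁺ i ≤_) (sym (Vec.insertAt-lookup e q x)) (lookup-insertAt-≤ i))
        ... | punch _ | punch _ | here    =
          ℕ.<⇒≱ b<a (insertAt-ascending i j (ℕ.<⇒≤ i<j) (ℕ.<-trans j<k ℕ.≤-refl))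
        ... | punch a | punch b | punch c = avoids a b c (punchIn-cancel-< q i<j) (punchIn-cancel-< q j<k)
          ( subst₂ _<_ (Vec.insertAt-punchIn e q x b) (Vec.insertAt-punchIn e q x a) b<a
          , subst₂ _<_ (Vec.insertAt-punchIn e q x a) (Vec.insertAt-punchIn e q x c) a<c)

-- The insertion bijection

record S (n s : ℕ) (e : Vec ℕ n) : Set where
  constructor _,_
  field
    valid  : Valid e
    fdes-≡ : fdes e ≡ max e + s

record S≥ (n s : ℕ) (e : Vec ℕ n) : Set where
  constructor _,_
  field
    valid  : Valid e
    ≤-fdes : max e + s ≤ fdes e

-- The lower bound on `q` makes the value q - s at least `max e`, hence the maximum after insertion;
-- the upper bound keeps everything before `q` ascending.
record T (n s : ℕ) (eq : Vec ℕ n × Fin (suc n)) : Set where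
  constructor _,_
  field
    valid  : Valid (proj₁ eq)
    bounds : max (proj₁ eq) + s ≤ toℕ (proj₂ eq) × toℕ (proj₂ eq) ≤ fdes (proj₁ eq)

record X (n s : ℕ) (e : Vec ℕ n) : Set where
  constructor _,_
  field
    valid : Valid e
    peak  : max e + s < fdes e × (∀ i → toℕ i ≡ max e + s → lookup e i ≡ max e)

insertPeak : ℕ → Vec ℕ n × Fin (suc n) → Vec ℕ (suc n)
insertPeak s (e , q) = insertAt e q (toℕ q ∸ s)

module _ {s : ℕ} where

  s≤q : ∀ (e : Vec ℕ n) {q} → T n s (e , q) → s ≤ toℕ q
  s≤q e (_ , m+s≤q , _) = ℕ.≤-trans (ℕ.m≤n+m s (max e)) m+s≤q

  max-insertPeak : ∀ {e} {q : Fin (suc n)} → T n s (e , q) → max (insertPeak s (e , q)) ≡ toℕ q ∸ s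
  max-insertPeak {e = e} {q} (_ , m+s≤q , _) = max-insertAt e q _ (ℕ.m+n≤o⇒m≤o∸n (max e) m+s≤q)

  max-insertPeak+s : ∀ {e} {q : Fin (suc n)} → T n s (e , q) → max (insertPeak s (e , q)) + s ≡ toℕ q
  max-insertPeak+s {e = e} t = trans (cong (_+ s) (max-insertPeak t)) (ℕ.m∸n+n≡m (s≤q e t))

  insertPeak-X : ∀ {eq} → T n s eq → X (suc n) s (insertPeak s eq)
  insertPeak-X {eq = e , q} t@(valid , m+s≤q , q≤fdes) =
      insertAt-valid e q _ max≤ q≤fdes (ℕ.m∸n≤m (toℕ q) s) valid
    , subst (_< fdes (insertPeak s (e , q))) (sym (max-insertPeak+s t)) (fdes-insertAt-> e q _ max≤ q≤fdes)
    , λ i i≡ → subst (λ i → lookup (insertPeak s (e , q)) i ≡ max (insertPeak s (e , q)))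
                 (Fin.toℕ-injective (sym (trans i≡ (max-insertPeak+s t))))
                 (trans (Vec.insertAt-lookup e q _) (sym (max-insertPeak t)))
    where
    max≤ : max e ≤ toℕ q ∸ s
    max≤ = ℕ.m+n≤o⇒m≤o∸n (max e) m+s≤q

  -- The position is recovered from the result as its maximum plus s; removing the entry there
  -- recovers the sequence.
  insertPeak-injective : ∀ {eq eq′} → T n s eq → T n s eq′ → insertPeak s eq ≡ insertPeak s eq′ → eq ≡ eq′
  insertPeak-injective {eq = e , q} {e′ , q′} t t′ eq
    with Fin.toℕ-injective (trans (sym (max-insertPeak+s t))
           (trans (cong (λ e → max e + s) eq) (max-insertPeak+s t′)))
  ... | refl = cong (_, q) (trans (sym (Vec.removeAt-insertAt e q _))
                 (trans (cong (λ e → removeAt e q) eq) (Vec.removeAt-insertAt e′ q _)))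

  -- The preimage is obtained by removing the entry at position max e + s. This cannot raise the
  -- maximum and lowers `fdes` by at most one, which gives both bounds of `T`.
  insertPeak-surjective : ∀ {e} → X (suc n) s e → ∃[ eq ] T n s eq × insertPeak s eq ≡ e
  insertPeak-surjective {n} {e} (valid , m+s<fdes , at-max) =
    (removeAt e q , q) , (valid⁻ , m⁻+s≤q , q≤fdes⁻) , inserted
    where
    m+s<1+n : max e + s < suc n
    m+s<1+n = ℕ.<-≤-trans m+s<fdes (fdes≤n e)
    q : Fin (suc n)
    q = fromℕ< m+s<1+n
    toℕ-q : toℕ q ≡ max e + s
    toℕ-q = Fin.toℕ-fromℕ< m+s<1+n
    x = toℕ q ∸ s
    x≡max : x ≡ max e
    x≡max = trans (cong (_∸ s) toℕ-q) (ℕ.m+n∸n≡m (max e) s)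
    inserted : insertAt (removeAt e q) q x ≡ e
    inserted = trans (cong (insertAt (removeAt e q) q) (trans x≡max (sym (at-max q toℕ-q)))) (Vec.insertAt-removeAt e q)
    valid⁻ : Valid (removeAt e q)
    valid⁻ = removeAt-valid (removeAt e q) q x (trans (cong max inserted) (sym x≡max))
               (ℕ.m∸n≤m (toℕ q) s) (subst Valid (sym inserted) valid)
    m⁻+s≤q : max (removeAt e q) + s ≤ toℕ q
    m⁻+s≤q = ℕ.≤-trans (ℕ.+-monoˡ-≤ s (subst (max (removeAt e q) ≤_) (cong max inserted)
                 (max-insertAt-≥ (removeAt e q) q x)))
               (ℕ.≤-reflexive (sym toℕ-q))
    q≤fdes⁻ : toℕ q ≤ fdes (removeAt e q)
    q≤fdes⁻ = ℕ.≤-pred (ℕ.≤-trans (subst (_< fdes e) (sym toℕ-q) m+s<fdes)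
                (subst (λ e′ → fdes e′ ≤ suc (fdes (removeAt e q))) inserted (fdes-insertAt-≤ (removeAt e q) q x)))


  -- The reduction mod n + 1 only makes the function total: on X n s it is the identity.
  repeatMax : Vec ℕ n → Vec ℕ (suc n)
  repeatMax {n} e = insertPeak s (e , (max e + s) mod suc n)

  X⇒T : ∀ {e : Vec ℕ n} → X n s e → T n s (e , (max e + s) mod suc n) × toℕ ((max e + s) mod suc n) ≡ max e + s
  X⇒T {n} {e} (valid , m+s<fdes , _) =
    (valid , ℕ.≤-reflexive (sym toℕ-q) , ℕ.≤-trans (ℕ.≤-reflexive toℕ-q) (ℕ.<⇒≤ m+s<fdes)) , toℕ-q
    where
    toℕ-q : toℕ ((max e + s) mod suc n) ≡ max e + s
    toℕ-q = trans (Fin.toℕ-fromℕ< _) (m<n⇒m%n≡m (ℕ.<-trans m+s<fdes (s≤s (fdes≤n e))))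

  -- The inserted value equals `max e`, and the old copy moves to q + 1 beside the new one. The
  -- ascending prefix thus reaches length q + 2, one more than equality with max + s + 1 would
  -- allow.
  repeatMax-X : ∀ {e : Vec ℕ n} → X n s e → X (suc n) s (repeatMax e) × fdes (repeatMax e) ≢ max (repeatMax e) + suc s
  repeatMax-X {n} {e} x@(valid , m+s<fdes , at-max) with X⇒T x
  ... | t , toℕ-q = insertPeak-X t ,
    ℕ.<⇒≢ (subst (_< fdes e⁺) (sym (trans (ℕ.+-suc (max e⁺) s) (cong suc (max-insertPeak+s t)))) q+1<fdes) ∘ sym
    where
    q = (max e + s) mod suc n
    e⁺ = repeatMax e
    q<n : toℕ q < n
    q<n = subst (_< n) (sym toℕ-q) (ℕ.<-≤-trans m+s<fdes (fdes≤n e))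
    j₀ : Fin n
    j₀ = fromℕ< q<n
    toℕ-j₀ : toℕ j₀ ≡ toℕ q
    toℕ-j₀ = Fin.toℕ-fromℕ< q<n
    lookup-j : ∀ j → toℕ j ≡ suc (toℕ q) → lookup e⁺ j ≡ max e⁺
    lookup-j j j≡ = begin
      lookup e⁺ j               ≡⟨ cong (lookup e⁺) (Fin.toℕ-injective (trans j≡ (sym
                                     (trans (punchIn-above q j₀ (ℕ.≤-reflexive (sym toℕ-j₀))) (cong suc toℕ-j₀))))) ⟩
      lookup e⁺ (punchIn q j₀)  ≡⟨ Vec.insertAt-punchIn e q _ j₀ ⟩
      lookup e j₀               ≡⟨ at-max j₀ (trans toℕ-j₀ toℕ-q) ⟩
      max e                     ≡⟨ ℕ.m+n∸n≡m (max e) s ⟨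
      max e + s ∸ s             ≡⟨ cong (_∸ s) toℕ-q ⟨
      toℕ q ∸ s                 ≡⟨ max-insertPeak t ⟨
      max e⁺                    ∎
    ascending : Ascending (suc (suc (toℕ q))) e⁺
    ascending i j i≤j j<q+2 with ℕ.m≤n⇒m<n∨m≡n (ℕ.≤-pred j<q+2)
    ... | inj₁ j<q+1 = fdes-ascending e⁺ i j i≤j (ℕ.≤-<-trans (ℕ.≤-pred j<q+1)
                         (subst (_< fdes e⁺) (max-insertPeak+s t) (proj₁ (X.peak (insertPeak-X t)))))
    ... | inj₂ j≡q+1 = subst (lookup e⁺ i ≤_) (sym (lookup-j j j≡q+1)) (lookup≤max e⁺ i)
    q+1<fdes : suc (toℕ q) < fdes e⁺
    q+1<fdes = ascending⇒≤fdes e⁺ (suc (suc (toℕ q))) (s≤s q<n) ascending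

  -- If `fdes` exceeds max + s + 1, the entry after the peak lies in the ascending prefix and so
  -- repeats the maximum; removing one copy keeps the maximum and leaves the other at position max +
  -- s.
  repeatMax-surjective : ∀ {e} → X (suc n) s e × fdes e ≢ max e + suc s → ∃[ e⁻ ] X n s e⁻ × repeatMax e⁻ ≡ e
  repeatMax-surjective {n} {e′} (x@(valid , m+s<fdes , at-max) , fdes≢) with insertPeak-surjective {e = e′} x
  ... | (e , q) , t@(valid⁻ , m⁻+s≤q , q≤fdes⁻) , refl =
    e , x⁻ , cong (λ q → insertPeak s (e , q)) (Fin.toℕ-injective (trans (proj₂ (X⇒T x⁻)) (sym q≡m⁻+s)))
    where
    e⁺ = insertPeak s (e , q)
    q+1<fdes : suc (toℕ q) < fdes e⁺
    q+1<fdes = subst (_< fdes e⁺) (cong suc (max-insertPeak+s t))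
      (ℕ.≤∧≢⇒< m+s<fdes (fdes≢ ∘ λ eq → trans (sym eq) (sym (ℕ.+-suc (max e⁺) s))))
    q<fdes⁻ : toℕ q < fdes e
    q<fdes⁻ = ℕ.≤-pred (ℕ.≤-trans q+1<fdes (fdes-insertAt-≤ e q _))
    at-q : ∀ i → toℕ i ≡ toℕ q → max e⁺ ≤ lookup e i
    at-q i i≡ = subst₂ _≤_ (trans (Vec.insertAt-lookup e q _) (sym (max-insertPeak t))) (Vec.insertAt-punchIn e q _ i)
      (fdes-ascending e⁺ q (punchIn q i)
        (ℕ.≤-trans (ℕ.≤-reflexive (sym i≡)) (punchIn-≥ q i))
        (ℕ.≤-<-trans (ℕ.≤-trans (punchIn-≤ q i) (ℕ.≤-reflexive (cong suc i≡))) q+1<fdes))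
    i₀ : Fin n
    i₀ = fromℕ< (ℕ.<-≤-trans q<fdes⁻ (fdes≤n e))
    max≡ : max e ≡ max e⁺
    max≡ = ℕ.≤-antisym (max-insertAt-≥ e q _) (ℕ.≤-trans (at-q i₀ (Fin.toℕ-fromℕ< _)) (lookup≤max e i₀))
    q≡m⁻+s : toℕ q ≡ max e + s
    q≡m⁻+s = trans (sym (max-insertPeak+s t)) (cong (_+ s) (sym max≡))
    at-max⁻ : ∀ i → toℕ i ≡ max e + s → lookup e i ≡ max e
    at-max⁻ i i≡ = ℕ.≤-antisym (lookup≤max e i)
      (ℕ.≤-trans (ℕ.≤-reflexive max≡) (at-q i (trans i≡ (sym q≡m⁻+s))))
    x⁻ : X n s e
    x⁻ = valid⁻ , subst (_< fdes e) q≡m⁻+s q<fdes⁻ , at-max⁻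

-- Descending induction on s: `k` measures how far s is from exceeding n, where the set is empty
-- because `fdes` is at most n. Each step splits off equality, as `G-h` does; a factor (1 - W)⁻¹ is
-- summation over all larger s.
card-S≥ : ∀ n → (∀ s → Card (S n s) (G n s 0)) → ∀ k s → n < s + k → Card (S≥ n s) (G n s 1)
card-S≥ n card-S zero    s n<s   = subst (Card _) (sym (n<s⇒G≡0 n s 1 n<s′)) (card-∅ λ {e} (_ , m+s≤fdes) →
    ℕ.<⇒≱ n<s′ (ℕ.≤-trans (ℕ.m≤n+m s (max e)) (ℕ.≤-trans m+s≤fdes (fdes≤n e))))
  where n<s′ = subst (n <_) (ℕ.+-identityʳ s) n<s
card-S≥ n card-S (suc k) s n<s+k = card-image (λ e → e) ⇒ (λ _ _ eq → eq) (λ p → _ , ⇐ p , refl) (sym (G-h n s 0))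
  (card-⊎ (λ {e} (_ , eq) (_ , le) → ℕ.<⇒≢ (subst (_≤ fdes e) (ℕ.+-suc (max e) s) le) (sym eq))
    (card-S s) (card-S≥ n card-S k (suc s) (subst (n <_) (ℕ.+-suc s k) n<s+k)))
  where
  ⇒ : ∀ {e} → S n s e ⊎ S≥ n (suc s) e → S≥ n s e
  ⇒     (inj₁ (valid , eq)) = valid , ℕ.≤-reflexive (sym eq)
  ⇒ {e} (inj₂ (valid , le)) = valid , ℕ.≤-trans (ℕ.+-monoʳ-≤ (max e) (ℕ.n≤1+n s)) le
  ⇐ : ∀ {e} → S≥ n s e → S n s e ⊎ S≥ n (suc s) e
  ⇐ {e} (valid , le) with ℕ.m≤n⇒m<n∨m≡n le
  ... | inj₁ lt = inj₂ (valid , subst (_≤ fdes e) (sym (ℕ.+-suc (max e) s)) lt)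
  ... | inj₂ eq = inj₁ (valid , sym eq)

T= T< : (n s : ℕ) → Vec ℕ n × Fin (suc n) → Set
T= n s eq = T n s eq × toℕ (proj₂ eq) ≡ fdes (proj₁ eq)
T< n s eq = T n s eq × toℕ (proj₂ eq) < fdes (proj₁ eq)

card-T= : ∀ {n s z} → Card (S≥ n s) z → Card (T= n s) z
card-T= {n} {s} = card-image (λ e → e , top e)
  (λ {e} (valid , le) → (valid , subst (max e + s ≤_) (sym (toℕ-top e)) le , ℕ.≤-reflexive (toℕ-top e)) , toℕ-top e)
  (λ { _ _ eq → cong proj₁ eq })
  (λ { {e , q} ((valid , m+s≤q , _) , q≡fdes) → e , (valid , subst (max e + s ≤_) q≡fdes m+s≤q)
     , cong (e ,_) (Fin.toℕ-injective (trans (toℕ-top e) (sym q≡fdes))) })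
  refl
  where
  top : Vec ℕ n → Fin (suc n)
  top e = fromℕ< (s≤s (fdes≤n e))
  toℕ-top : ∀ e → toℕ (top e) ≡ fdes e
  toℕ-top e = Fin.toℕ-fromℕ< (s≤s (fdes≤n e))

-- Lowering `q` by one trades a lower bound with `suc s` for a strict upper bound. Together with the
-- pairs having q = `fdes e`, this yields the second factor (1 - W)⁻¹.
card-T< : ∀ {n s z} → Card (T n (suc s)) z → Card (T< n s) z
card-T< {n} {s} = card-image (λ (e , q) → e , Fin.pred q) to pred-injective from refl
  where
  -- The bound max e + (s + 1) ≤ q excludes q = 0, where `Fin.pred` would not decrease.
  positive : ∀ {e q} → T n (suc s) (e , q) → ∃[ q′ ] q ≡ suc q′
  positive {e} {zero}  (_ , m+s≤0 , _) with () ← subst (_≤ 0) (ℕ.+-suc (max e) s) m+s≤0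
  positive {e} {suc q} _               = q , refl
  to : ∀ {eq} → T n (suc s) eq → T< n s (proj₁ eq , Fin.pred (proj₂ eq))
  to {e , q} t@(valid , m+s≤q , q≤fdes) with positive t
  ... | q′ , refl = (valid , m+s≤q′ , ℕ.≤-trans (ℕ.<⇒≤ ≤q′) q≤fdes) , ℕ.≤-trans ≤q′ q≤fdes
    where
    ≤q′ : toℕ (Fin.inject₁ q′) < suc (toℕ q′)
    ≤q′ = s≤s (ℕ.≤-reflexive (Fin.toℕ-inject₁ q′))
    m+s≤q′ : max e + s ≤ toℕ (Fin.inject₁ q′)
    m+s≤q′ = subst (max e + s ≤_) (sym (Fin.toℕ-inject₁ q′)) (ℕ.≤-pred (subst (_≤ suc (toℕ q′)) (ℕ.+-suc (max e) s) m+s≤q))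
  pred-injective : ∀ {eq eq′} → T n (suc s) eq → T n (suc s) eq′ →
              (proj₁ eq , Fin.pred (proj₂ eq)) ≡ (proj₁ eq′ , Fin.pred (proj₂ eq′)) → eq ≡ eq′
  pred-injective {e , q} {e′ , r} t t′ eq with positive t | positive t′
  ... | q′ , refl | r′ , refl = cong₂ _,_ (cong proj₁ eq) (cong suc (Fin.inject₁-injective (cong proj₂ eq)))
  from : ∀ {eq} → T< n s eq → ∃[ eq′ ] T n (suc s) eq′ × (proj₁ eq′ , Fin.pred (proj₂ eq′)) ≡ eq
  from {e , q} ((valid , m+s≤q , _) , q<fdes) = (e , suc q′)
    , (valid , subst (_≤ suc (toℕ q′)) (sym (ℕ.+-suc (max e) s)) (s≤s (subst (max e + s ≤_) (sym toℕ-q′) m+s≤q))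
             , subst (_≤ fdes e) (cong suc (sym toℕ-q′)) q<fdes)
    , cong (e ,_) (Fin.toℕ-injective (trans (Fin.toℕ-inject₁ q′) toℕ-q′))
    where
    q<n : toℕ q < n
    q<n = ℕ.<-≤-trans q<fdes (fdes≤n e)
    q′ : Fin n
    q′ = fromℕ< q<n
    toℕ-q′ : toℕ q′ ≡ toℕ q
    toℕ-q′ = Fin.toℕ-fromℕ< q<n

card-T : ∀ n → (∀ s → Card (S n s) (G n s 0)) → ∀ k s → n < s + k → Card (T n s) (G n s 2)
card-T n card-S zero    s n<s   = subst (Card _) (sym (n<s⇒G≡0 n s 2 n<s′))
  (card-∅ λ { {e , q} (_ , m+s≤q , _) →
    ℕ.<⇒≱ n<s′ (ℕ.≤-trans (ℕ.m≤n+m s (max e)) (ℕ.≤-trans m+s≤q (ℕ.≤-pred (Fin.toℕ<n q)))) })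
  where n<s′ = subst (n <_) (ℕ.+-identityʳ s) n<s
card-T n card-S (suc k) s n<s+k = card-image (λ eq → eq) [ proj₁ , proj₁ ]′ (λ _ _ eq → eq) (λ t → _ , ⇐ t , refl)
  (sym (G-h n s 1))
  (card-⊎ (λ (_ , eq) (_ , lt) → ℕ.<⇒≢ lt eq)
    (card-T= (card-S≥ n card-S (suc k) s n<s+k))
    (card-T< (card-T n card-S k (suc s) (subst (n <_) (ℕ.+-suc s k) n<s+k))))
  where
  ⇐ : ∀ {eq} → T n s eq → T= n s eq ⊎ T< n s eq
  ⇐ t@(_ , _ , q≤fdes) with ℕ.m≤n⇒m<n∨m≡n q≤fdes
  ... | inj₁ lt = inj₂ (t , lt)
  ... | inj₂ eq = inj₁ (t , eq)

-- Insertion identifies `X` at length n + 1 with `T` at length n; at length 0 nothing satisfies the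
-- strict bound on `fdes`.
∣X∣ : (n s : ℕ) → ℤ
∣X∣ zero    s = 0ℤ
∣X∣ (suc n) s = G n s 2

-- Wˢ⁺¹ = (x - x²)Wˢ(1 - W)⁻²: the x counts all insertions, and -x² takes away those with a repeated
-- maximum.
G-∣X∣ : ∀ n s → ∣X∣ (suc n) s ℤ.- ∣X∣ n s ≡ G (suc n) (suc s) 0
G-∣X∣ zero    s = trans (ℤ.+-identityʳ _) (sym (G₁-s s 0))
G-∣X∣ (suc n) s = sym (G-s n s 0)

mutual
  card-S : ∀ n s → Card (S n s) (G n s 0)
  -- The dummy value `fdes [] = 0` places the empty sequence here, in accordance with the constant
  -- term 1 of W⁰.
  card-S zero    zero    = 1 , counted-singleton [] (((λ ()) , λ ()) , refl) (λ { {[]} _ → refl }) , refl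
  card-S zero    (suc s) = subst (Card _) (sym (n<s⇒G≡0 0 (suc s) 0 (s≤s z≤n))) (card-∅ λ { {[]} (_ , ()) })
  card-S (suc n) zero    = subst (Card _) (sym (G-zero n))
    (card-∅ λ {e} (valid , eq) → ℕ.<⇒≢ (max<fdes e valid) (sym (trans eq (ℕ.+-identityʳ (max e)))))
  card-S (suc n) (suc s) = card-image (λ e → e)
    (λ { ((valid , _) , eq) → valid , eq }) (λ _ _ eq → eq)
    -- When `fdes e` is max e + s + 1, position max e + s is the top of the first descent, so
    -- `peak≡max` supplies the peak condition of `X`.
    (λ {e} (valid , eq) → e , ((valid , ℕ.≤-reflexive (trans (sym (ℕ.+-suc (max e) s)) (sym eq))
        , λ i i≡ → peak≡max e valid (trans (cong suc i≡) (trans (sym (ℕ.+-suc (max e) s)) (sym eq)))) , eq) , refl)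
    (G-∣X∣ n s)
    (card-difference (λ e → fdes e ℕ.≟ max e + suc s) (card-X (suc n) s)
      (card-image repeatMax repeatMax-X
        (λ x x′ eq → cong proj₁ (insertPeak-injective (proj₁ (X⇒T x)) (proj₁ (X⇒T x′)) eq))
        repeatMax-surjective refl (card-X n s)))

  card-X : ∀ n s → Card (X n s) (∣X∣ n s)
  card-X zero    s = card-∅ λ { {[]} (_ , () , _) }
  card-X (suc n) s = card-image (insertPeak s) insertPeak-X insertPeak-injective insertPeak-surjective refl
    (card-T n (card-S n) (suc n) s (ℕ.m≤n+m (suc n) s))

-- Ranks and the common count

card-IS102 : ∀ n t → Card (λ e → IsInversionSequence {n} e × Avoids102 e × rank e ≡ + t) (G n (suc t) 0)
card-IS102 n t = card-image (λ e → e)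
  (λ { {e} ((inversion , avoids) , eq) → inversion , avoids , to e eq }) (λ _ _ eq → eq)
  (λ {e} (inversion , avoids , eq) → e , ((inversion , avoids) , from e eq) , refl) refl (card-S n (suc t))
  where
  cancel : ∀ m t → m ℤ.+ (1ℤ ℤ.+ t) ℤ.- m ℤ.- 1ℤ ≡ t
  cancel = ℤSolver.solve-∀
  restore : ∀ f m → f ≡ m ℤ.+ (1ℤ ℤ.+ (f ℤ.- m ℤ.- 1ℤ))
  restore = ℤSolver.solve-∀
  to : ∀ e → fdes e ≡ max e + suc t → rank e ≡ + t
  to e eq = trans (cong (λ f → + f ℤ.- + max e ℤ.- 1ℤ) eq) (cancel (+ max e) (+ t))
  from : ∀ e → rank e ≡ + t → fdes e ≡ max e + suc t
  from e eq = ℤ.+-injective (trans (restore (+ fdes e) (+ max e)) (cong (λ r → + max e ℤ.+ (1ℤ ℤ.+ r)) eq))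

theorem4p1 : (n t : ℕ) → 1 ≤ n → t ≤ n ∸ 1 →
    ∃[ k ] ((IS102 n t ↔ Fin k) × (UVD n t ↔ Fin k) × (+ k / 1 ≡ alternatingSum n t))
theorem4p1 (suc n) t _ t≤n =
  let k , words , k≡G = card-UVD (suc n) t
      l , sequences , l≡G = card-IS102 (suc n) t
      l≡k = ℤ.+-injective (trans l≡G (sym k≡G))
  in k , counted-↔ (Vec.≡-dec ℕ._≟_) (subst (Counted _) l≡k sequences)
       , counted-↔ (List.≡-dec _≟ˢ_) words
       , trans (cong (_/ 1) k≡G) (sym (alternatingSum≡G (s≤s t≤n)))
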